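{- $\mathrm{sat}_{\mathsf c}(4,5)=8<10=\mathrm{ram}_{\mathsf c}(4,5)$.
   Context: A planar point set is generic if no three of its points are collinear and its points have pairwise distinct $x$-coordinates; a point $p$ is generic with respect to $P$ if $P\cup\{p\}$ is generic. For generic points $p_1,\dots,p_m$ in increasing order of $x$-coordinate, they form an $m$-cup (resp. $m$-cap) if the slopes of the lines $p_ip_{i+1}$, $1\le i<m$, are increasing (resp. decreasing). A generic set is $(k,\ell)$-cup-cap-free if it contains no $k$-cup and no $\ell$-cap; it is $(k,\ell)$-cup-cap-saturated if it is $(k,\ell)$-cup-cap-free and for every point $q\notin P$ generic with respect to $P$, $P\cup\{q\}$ contains a $k$-cup or an $\ell$-cap. $\mathrm{ram}_{\mathsf c}(k,\ell)$ is the maximum size of a $(k,\ell)$-cup-cap-free generic set and $\mathrm{sat}_{\mathsf c}(k,\ell)$ the minimum size of a $(k,\ell)$-cup-cap-saturated set.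
   Formalization: Points of the plane, both those of the sets P and the added point q, have rational instead of real coordinates, so the maximum and minimum sizes are taken over rational point sets. -}

module Defs where

open import Data.Nat using (ℕ; _≤_)
open import Data.Rational using (ℚ; _<_; _*_; _-_)
open import Data.Product using (_×_; _,_; proj₁; proj₂; ∃-syntax)
open import Data.Sum using (_⊎_)
open import Data.Unit using (⊤)
open import Data.List using (List; []; _∷_; length)
open import Data.List.Relation.Unary.All using (All)
open import Data.List.Relation.Unary.AllPairs using (AllPairs)
open import Data.List.Membership.Propositional using (_∈_; _∉_)
open import Relation.Binary.PropositionalEquality using (_≡_; _≢_)
open import Relation.Nullary using (¬_)

Point : Set
Point = ℚ × ℚ

xc : Point → ℚ
xc = proj₁

yc : Point → ℚ
yc = proj₂

Collinear : Point → Point → Point → Set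
Collinear p q r =
  (xc q - xc p) * (yc r - yc p) ≡ (yc q - yc p) * (xc r - xc p)

-- A finite point set is a list; generic: pairwise distinct x-coordinates
-- (which also makes the list duplicate-free) and no three points collinear.
Generic : List Point → Set
Generic P =
  AllPairs (λ p q → xc p ≢ xc q) P ×
  (∀ p q r → p ∈ P → q ∈ P → r ∈ P →
     xc p < xc q → xc q < xc r → ¬ Collinear p q r)

XIncreasing : List Point → Set
XIncreasing [] = ⊤
XIncreasing (p ∷ []) = ⊤
XIncreasing (p ∷ q ∷ rest) = (xc p < xc q) × XIncreasing (q ∷ rest)

-- slope(p,q) < slope(q,r), for xc p < xc q < xc r, written with the
-- (positive) denominators cleared.
SlopeLt : Point → Point → Point → Set
SlopeLt p q r = (yc q - yc p) * (xc r - xc q) < (yc r - yc q) * (xc q - xc p)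

SlopeGt : Point → Point → Point → Set
SlopeGt p q r = (yc r - yc q) * (xc q - xc p) < (yc q - yc p) * (xc r - xc q)

SlopesIncreasing : List Point → Set
SlopesIncreasing (p ∷ q ∷ r ∷ rest) = SlopeLt p q r × SlopesIncreasing (q ∷ r ∷ rest)
SlopesIncreasing _ = ⊤

SlopesDecreasing : List Point → Set
SlopesDecreasing (p ∷ q ∷ r ∷ rest) = SlopeGt p q r × SlopesDecreasing (q ∷ r ∷ rest)
SlopesDecreasing _ = ⊤

IsCup : ℕ → List Point → Set
IsCup m C = length C ≡ m × XIncreasing C × SlopesIncreasing C

IsCap : ℕ → List Point → Set
IsCap m C = length C ≡ m × XIncreasing C × SlopesDecreasing C

HasCup : ℕ → List Point → Set
HasCup m P = ∃[ C ] (All (_∈ P) C × IsCup m C)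

HasCap : ℕ → List Point → Set
HasCap m P = ∃[ C ] (All (_∈ P) C × IsCap m C)

CupCapFree : ℕ → ℕ → List Point → Set
CupCapFree k l P = Generic P × ¬ HasCup k P × ¬ HasCap l P

CupCapSaturated : ℕ → ℕ → List Point → Set
CupCapSaturated k l P =
  CupCapFree k l P ×
  (∀ q → q ∉ P → Generic (q ∷ P) → HasCup k (q ∷ P) ⊎ HasCap l (q ∷ P))

RamC≡ : ℕ → ℕ → ℕ → Set
RamC≡ k l n =
  (∃[ P ] (CupCapFree k l P × length P ≡ n)) ×
  (∀ P → CupCapFree k l P → length P ≤ n)

SatC≡ : ℕ → ℕ → ℕ → Set
SatC≡ k l n =
  (∃[ P ] (CupCapSaturated k l P × length P ≡ n)) ×
  (∀ P → CupCapSaturated k l P → n ≤ length P)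

module Submission where

-- ram(4,5) ≤ 10 is the argument of Erdős and Szekeres for k-cups and l-caps: either the set E of
-- last points of (k-1)-cups contains an (l-1)-cap, and where that cap meets a (k-1)-cup one of the
-- two can be lengthened, or the complement of E is large, and it has no (k-1)-cup.
--
-- sat(4,5) ≥ 8: a point far below P, over a gap splitting P into L and M, creates no 4-cup, and
-- creates a 5-cap only from a 4-cap in L or in M. With at most six points, splitting off the first
-- three is therefore enough. With seven points p₁ … p₇, the splits after p₃ and after p₄ can fail
-- only if p₁ p₂ p₃ p₄ and p₄ p₅ p₆ p₇ are caps; then there is no 3-cup on either side of the gap
-- after p₄, and a point far above P over this gap can be added.
--
-- sat(4,5) ≤ 8: for an explicit set of eight points, a decision tree over the position of the new
-- point relative to the given points and the lines through them ends in an explicit 4-cup or 5-cap,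
-- or in a nonnegative combination of the assumed inequalities that is contradictory.

open import Defs
open import Data.Empty using (⊥)
open import Data.Integer using (+_)
open import Data.List using (List; []; _∷_; _++_; length; filter; take; drop; map; zipWith; upTo)
open import Data.List.Membership.Propositional using (_∈_; _∉_; find; lose)
open import Data.List.Membership.Propositional.Properties using (∈-filter⁻; ∈-++⁻)
import Data.List.Membership.DecPropositional as DecMembership
open import Data.List.Properties using (length-map; length-take; length-drop; take++drop≡id)
open import Data.List.Relation.Binary.Permutation.Propositional as Perm using (_↭_; ↭-sym)
open import Data.List.Relation.Binary.Permutation.Propositional.Properties
  using (All-resp-↭; ∈-resp-↭; ↭-length)
open import Data.List.Relation.Binary.Sublist.Propositional using (_⊆_; []; _∷_; _∷ʳ_; minimum)
open import Data.List.Relation.Binary.Sublist.Heterogeneous.Properties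
  using (length-mono-≤; toPointwise)
open import Data.List.Relation.Binary.Pointwise using (Pointwise-≡⇒≡)
open import Data.List.Relation.Unary.All as All using (All; []; _∷_; all?)
open import Data.List.Relation.Unary.AllPairs as AllPairs using (AllPairs; []; _∷_; allPairs?)
import Data.List.Relation.Unary.All.Properties as All
import Data.List.Relation.Unary.AllPairs.Properties as AllPairs
open import Data.List.Relation.Unary.Linked using (Linked; []; [-]; _∷_)
open import Data.List.Relation.Unary.Linked.Properties using (Linked⇒AllPairs)
open import Data.List.Relation.Unary.Sorted.TotalOrder.Properties using (Sorted⇒AllPairs)
import Data.List.Sort as Sort
import Relation.Binary.Construct.On as On
open import Data.List.Relation.Unary.Any using (Any; here; there; any?)
open import Data.Maybe using (Maybe; just; nothing; fromMaybe)
open import Data.Nat using (ℕ; zero; suc; _<_; _≤_; s≤s; s≤s⁻¹)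
import Data.Nat as ℕ
import Data.Nat.Properties as ℕ
open import Data.Product using (_×_; _,_; proj₁; proj₂; ∃-syntax)
open import Data.Product.Properties using (≡-dec)
open import Data.Rational using (ℚ; _+_; _*_; _-_; -_; 0ℚ; 1ℚ; _/_; 1/_; positive)
import Data.Rational as ℚ
import Data.Rational.Properties as ℚ
open import Data.Rational.Solver using (module +-*-Solver)
open import Data.Sum using (_⊎_; inj₁; inj₂; [_,_]′)
open import Data.Unit using (⊤; tt)
open import Function using (_∘_)
open import Relation.Binary.Bundles using (DecTotalOrder)
open import Relation.Binary.Definitions using (tri<; tri≈; tri>)
open import Relation.Binary.PropositionalEquality
  using (_≡_; _≢_; refl; sym; trans; cong; subst; subst₂; ≢-sym; module ≡-Reasoning)
open import Relation.Nullary using (¬_; Dec; yes; no; contradiction)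
open import Relation.Nullary.Decidable using (_×-dec_; _→-dec_; ¬?; from-yes; map′)

open +-*-Solver using (solve; con; _:+_; _:*_; _:-_; :-_; _:=_)

open DecMembership (≡-dec ℚ._≟_ ℚ._≟_) using (_∈?_)

private
  variable
    x y : ℚ
    a b c d p q r : Point
    k l m n : ℕ
    P Q L M C : List Point

-- Order and sign rules for rationals.

x<y⇒0<y-x : x ℚ.< y → 0ℚ ℚ.< y - x
x<y⇒0<y-x {x} {y} x<y = subst (ℚ._< y - x) (ℚ.+-inverseʳ x) (ℚ.+-monoˡ-< (- x) x<y)

0<y-x⇒x<y : 0ℚ ℚ.< y - x → x ℚ.< y
0<y-x⇒x<y {y} {x} 0<y-x = subst₂ ℚ._<_ (ℚ.+-identityˡ x)
  (solve 2 (λ y x → (y :- x) :+ x := y) refl y x) (ℚ.+-monoˡ-< x 0<y-x)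

x-y≡0⇒x≡y : x - y ≡ 0ℚ → x ≡ y
x-y≡0⇒x≡y {x} {y} x-y≡0 =
  trans (solve 2 (λ x y → x := (x :- y) :+ y) refl x y)
        (trans (cong (_+ y) x-y≡0) (ℚ.+-identityˡ y))

*-pos : 0ℚ ℚ.< x → 0ℚ ℚ.< y → 0ℚ ℚ.< x * y
*-pos {x} {y} 0<x 0<y =
  subst (ℚ._< x * y) (ℚ.*-zeroʳ x) (ℚ.*-monoʳ-<-pos x {{positive 0<x}} 0<y)

+-pos : 0ℚ ℚ.< x → 0ℚ ℚ.< y → 0ℚ ℚ.< x + y
+-pos 0<x 0<y = ℚ.+-mono-< 0<x 0<y

*-cancelʳ-pos : 0ℚ ℚ.< y → 0ℚ ℚ.< x * y → 0ℚ ℚ.< x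
*-cancelʳ-pos {y} {x} 0<y 0<xy = ℚ.*-cancelʳ-<-nonNeg y {{ℚ.pos⇒nonNeg y {{positive 0<y}}}}
  (subst (ℚ._< x * y) (sym (ℚ.*-zeroˡ y)) 0<xy)

neg-≢0 : x ≢ 0ℚ → ¬ 0ℚ ℚ.< x → 0ℚ ℚ.< - x
neg-≢0 {x} x≢0 x≯0 with ℚ.<-cmp 0ℚ x
... | tri< 0<x _ _ = contradiction 0<x x≯0
... | tri≈ _ 0≡x _ = contradiction (sym 0≡x) x≢0
... | tri> _ _ x<0 = ℚ.neg-antimono-< x<0

≤∧≢⇒< : x ℚ.≤ y → x ≢ y → x ℚ.< y
≤∧≢⇒< x≤y x≢y = ℚ.≰⇒> λ y≤x → x≢y (ℚ.≤-antisym x≤y y≤x)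

ℚ-unbounded-below : ∀ x → ∃[ y ] y ℚ.< x
ℚ-unbounded-below x =
  x - 1ℚ , subst (x - 1ℚ ℚ.<_) (ℚ.+-identityʳ x) (ℚ.+-monoʳ-< x (from-yes (- 1ℚ ℚ.<? 0ℚ)))

ℚ-unbounded-above : ∀ x → ∃[ y ] x ℚ.< y
ℚ-unbounded-above x =
  x + 1ℚ , subst (ℚ._< x + 1ℚ) (ℚ.+-identityʳ x) (ℚ.+-monoʳ-< x (from-yes (0ℚ ℚ.<? 1ℚ)))

-- Orientations of triples of points.

-- Twice the signed area of the triangle p q r, positive if p q r turns to the left.
det : Point → Point → Point → ℚ
det p q r = (yc r - yc q) * (xc q - xc p) - (yc q - yc p) * (xc r - xc q)

det-rotate : ∀ p q r → det p q r ≡ det q r p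
det-rotate (a , b) (c , d) (e , f) = solve 6 (λ a b c d e f →
  (f :- d) :* (c :- a) :- (d :- b) :* (e :- c) :=
  (b :- f) :* (e :- c) :- (f :- d) :* (a :- e)) refl a b c d e f

det-reverse : ∀ p q r → det r q p ≡ - det p q r
det-reverse (a , b) (c , d) (e , f) = solve 6 (λ a b c d e f →
  (b :- d) :* (c :- e) :- (d :- f) :* (a :- c) :=
  :- ((f :- d) :* (c :- a) :- (d :- b) :* (e :- c))) refl a b c d e f

slopeLt⁺ : ∀ p q r → 0ℚ ℚ.< det p q r → SlopeLt p q r
slopeLt⁺ _ _ _ = 0<y-x⇒x<y

slopeLt⁻ : ∀ p q r → SlopeLt p q r → 0ℚ ℚ.< det p q r
slopeLt⁻ _ _ _ = x<y⇒0<y-x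

det-gt : ∀ p q r →
  det r q p ≡ (yc q - yc p) * (xc r - xc q) - (yc r - yc q) * (xc q - xc p)
det-gt (a , b) (c , d) (e , f) = solve 6 (λ a b c d e f →
  (b :- d) :* (c :- e) :- (d :- f) :* (a :- c) :=
  (d :- b) :* (e :- c) :- (f :- d) :* (c :- a)) refl a b c d e f

-- Reversing the triple turns a right turn into a positivity statement too, so that turns of both
-- kinds are handled by strict positivity of `det`.
slopeGt⁺ : ∀ p q r → 0ℚ ℚ.< det r q p → SlopeGt p q r
slopeGt⁺ p q r = 0<y-x⇒x<y ∘ subst (0ℚ ℚ.<_) (det-gt p q r)

slopeGt⁻ : ∀ p q r → SlopeGt p q r → 0ℚ ℚ.< det r q p
slopeGt⁻ p q r = subst (0ℚ ℚ.<_) (sym (det-gt p q r)) ∘ x<y⇒0<y-x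

slopeLt? : ∀ p q r → Dec (SlopeLt p q r)
slopeLt? p q r = _ ℚ.<? _

slopeGt? : ∀ p q r → Dec (SlopeGt p q r)
slopeGt? p q r = _ ℚ.<? _

collinear? : ∀ p q r → Dec (Collinear p q r)
collinear? p q r = _ ℚ.≟ _

det-collinear : ∀ p q r →
  det p q r ≡ (xc q - xc p) * (yc r - yc p) - (yc q - yc p) * (xc r - xc p)
det-collinear (a , b) (c , d) (e , f) = solve 6 (λ a b c d e f →
  (f :- d) :* (c :- a) :- (d :- b) :* (e :- c) :=
  (c :- a) :* (f :- b) :- (d :- b) :* (e :- a)) refl a b c d e f

det≡0⇒collinear : ∀ p q r → det p q r ≡ 0ℚ → Collinear p q r
det≡0⇒collinear p q r = x-y≡0⇒x≡y ∘ trans (sym (det-collinear p q r))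

collinear⇒det≡0 : ∀ p q r → Collinear p q r → det p q r ≡ 0ℚ
collinear⇒det≡0 p q r coll = trans (det-collinear p q r)
  (trans (cong (_- (yc q - yc p) * (xc r - xc p)) coll)
         (ℚ.+-inverseʳ ((yc q - yc p) * (xc r - xc p))))

infix 4 _<ₓ_
_<ₓ_ : Point → Point → Set
p <ₓ q = xc p ℚ.< xc q

<ₓ-trans : p <ₓ q → q <ₓ r → p <ₓ r
<ₓ-trans = ℚ.<-trans

turn : Generic P → a ∈ P → b ∈ P → c ∈ P → a <ₓ b → b <ₓ c → SlopeLt a b c ⊎ SlopeGt a b c
turn {a = a} {b} {c} (_ , nc) a∈ b∈ c∈ a<b b<c
  with ℚ.<-cmp ((yc b - yc a) * (xc c - xc b)) ((yc c - yc b) * (xc b - xc a))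
... | tri< lt _ _ = inj₁ lt
... | tri> _ _ gt = inj₂ gt
... | tri≈ _ eq _ = contradiction (det≡0⇒collinear a b c det≡0) (nc a b c a∈ b∈ c∈ a<b b<c)
  where
  det≡0 : det a b c ≡ 0ℚ
  det≡0 = trans (cong (_- (yc b - yc a) * (xc c - xc b)) (sym eq))
                (ℚ.+-inverseʳ ((yc b - yc a) * (xc c - xc b)))

-- Cups and caps as runs of a relation on consecutive triples.

module Runs (R : Point → Point → Point → Set) where

  Run : List Point → Set
  Run (p ∷ q ∷ r ∷ C) = R p q r × Run (q ∷ r ∷ C)
  Run _ = ⊤

  IsRun : ℕ → List Point → Set
  IsRun m C = length C ≡ m × XIncreasing C × Run C

  HasRun : ℕ → List Point → Set
  HasRun m P = ∃[ C ] (All (_∈ P) C × IsRun m C)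

  -- Unlike HasRun, the existence of n further points before or after an edge is decidable by search.
  RightExt : List Point → ℕ → Point → Point → Set
  RightExt P zero    a b = ⊤
  RightExt P (suc n) a b = Any (λ c → b <ₓ c × R a b c × RightExt P n b c) P

  LeftExt : List Point → ℕ → Point → Point → Set
  LeftExt P zero    b c = ⊤
  LeftExt P (suc n) b c = Any (λ a → a <ₓ b × R a b c × LeftExt P n a b) P

  run⇒rightExt : All (_∈ P) C → XIncreasing (b ∷ C) → Run (a ∷ b ∷ C) → RightExt P (length C) a b
  run⇒rightExt []         _           _         = tt
  run⇒rightExt (c∈ ∷ C∈) (b<c , inc) (R₁ , run) = lose c∈ (b<c , R₁ , run⇒rightExt C∈ inc run)

  rightExt⇒run : ∀ n → RightExt P n a b →
    ∃[ C ] (All (_∈ P) C × length C ≡ n × XIncreasing (b ∷ C) × Run (a ∷ b ∷ C))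
  rightExt⇒run zero    _   = [] , [] , refl , tt , tt
  rightExt⇒run (suc n) ext =
    let c , c∈ , b<c , R₁ , ext′ = find ext
        C , C∈ , len , inc , run = rightExt⇒run n ext′
    in c ∷ C , c∈ ∷ C∈ , cong suc len , (b<c , inc) , (R₁ , run)

  -- The search moves leftwards, so the points already found are carried along in the list, and each
  -- new point is put at its head.
  leftExt⇒run : ∀ n C → All (_∈ P) (b ∷ c ∷ C) → XIncreasing (b ∷ c ∷ C) → Run (b ∷ c ∷ C) →
    LeftExt P n b c → HasRun (n ℕ.+ length (b ∷ c ∷ C)) P
  leftExt⇒run zero    C ∈P inc run _ = _ , ∈P , refl , inc , run
  leftExt⇒run {P} (suc n) C ∈P inc run ext =
    let a , a∈ , a<b , R₁ , ext′ = find ext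
    in subst (λ m → HasRun m P) (ℕ.+-suc n _)
         (leftExt⇒run n (_ ∷ C) (a∈ ∷ ∈P) (a<b , inc) (R₁ , run) ext′)

  RightExt-mono : ∀ n → (∀ {p} → p ∈ P → p ∈ Q) → RightExt P n a b → RightExt Q n a b
  RightExt-mono zero    sub _   = tt
  RightExt-mono (suc n) sub ext =
    let c , c∈ , b<c , R₁ , ext′ = find ext
    in lose (sub c∈) (b<c , R₁ , RightExt-mono n sub ext′)

  LeftExt-mono : ∀ n → (∀ {p} → p ∈ P → p ∈ Q) → LeftExt P n b c → LeftExt Q n b c
  LeftExt-mono zero    sub _   = tt
  LeftExt-mono (suc n) sub ext =
    let a , a∈ , a<b , R₁ , ext′ = find ext
    in lose (sub a∈) (a<b , R₁ , LeftExt-mono n sub ext′)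

  -- The index counts the points beyond the starting edge (the first edge here, the last one in
  -- `LeftRun`): 4-cups have index 2 and 5-caps index 3.
  RightRun : ℕ → List Point → Set
  RightRun n P = Any (λ a → Any (λ b → a <ₓ b × RightExt P n a b) P) P

  LeftRun : ℕ → List Point → Set
  LeftRun n P = Any (λ b → Any (λ c → b <ₓ c × LeftExt P n b c) P) P

  hasRun⇒rightRun : HasRun (2 ℕ.+ n) P → RightRun n P
  hasRun⇒rightRun (_ , a∈ ∷ b∈ ∷ C∈ , refl , (a<b , inc) , run) =
    lose a∈ (lose b∈ (a<b , run⇒rightExt C∈ inc run))

  rightRun⇒hasRun : RightRun n P → HasRun (2 ℕ.+ n) P
  rightRun⇒hasRun {n} rr =
    let a , a∈ , br = find rr
        b , b∈ , a<b , ext = find br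
        C , C∈ , len , inc , run = rightExt⇒run n ext
    in a ∷ b ∷ C , a∈ ∷ b∈ ∷ C∈ , cong (2 ℕ.+_) len , (a<b , inc) , run

  leftRun⇒hasRun : LeftRun n P → HasRun (2 ℕ.+ n) P
  leftRun⇒hasRun {n} {P} lr =
    let b , b∈ , cr = find lr
        c , c∈ , b<c , ext = find cr
    in subst (λ m → HasRun m P) (ℕ.+-comm n 2)
         (leftExt⇒run n [] (b∈ ∷ c∈ ∷ []) (b<c , tt) tt ext)

  RightRun-mono : (∀ {p} → p ∈ P → p ∈ Q) → RightRun n P → RightRun n Q
  RightRun-mono {n = n} sub rr =
    let a , a∈ , br = find rr
        b , b∈ , a<b , ext = find br
    in lose (sub a∈) (lose (sub b∈) (a<b , RightExt-mono n sub ext))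

  LeftRun-mono : (∀ {p} → p ∈ P → p ∈ Q) → LeftRun n P → LeftRun n Q
  LeftRun-mono {n = n} sub lr =
    let b , b∈ , cr = find lr
        c , c∈ , b<c , ext = find cr
    in lose (sub b∈) (lose (sub c∈) (b<c , LeftExt-mono n sub ext))

  module _ (R? : ∀ p q r → Dec (R p q r)) where

    rightExt? : ∀ P n a b → Dec (RightExt P n a b)
    rightExt? P zero    a b = yes tt
    rightExt? P (suc n) a b =
      any? (λ c → (xc b ℚ.<? xc c) ×-dec (R? a b c ×-dec rightExt? P n b c)) P

    leftExt? : ∀ P n b c → Dec (LeftExt P n b c)
    leftExt? P zero    b c = yes tt
    leftExt? P (suc n) b c =
      any? (λ a → (xc a ℚ.<? xc b) ×-dec (R? a b c ×-dec leftExt? P n a b)) P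

    rightRun? : ∀ n P → Dec (RightRun n P)
    rightRun? n P = any? (λ a → any? (λ b → (xc a ℚ.<? xc b) ×-dec rightExt? P n a b) P) P

module Cup = Runs SlopeLt
module Cap = Runs SlopeGt

increasing⇒run : ∀ C → SlopesIncreasing C → Cup.Run C
increasing⇒run []              _         = tt
increasing⇒run (_ ∷ [])        _         = tt
increasing⇒run (_ ∷ _ ∷ [])    _         = tt
increasing⇒run (_ ∷ _ ∷ _ ∷ C) (lt , inc) = lt , increasing⇒run (_ ∷ _ ∷ C) inc

run⇒increasing : ∀ C → Cup.Run C → SlopesIncreasing C
run⇒increasing []              _         = tt
run⇒increasing (_ ∷ [])        _         = tt
run⇒increasing (_ ∷ _ ∷ [])    _         = tt
run⇒increasing (_ ∷ _ ∷ _ ∷ C) (lt , run) = lt , run⇒increasing (_ ∷ _ ∷ C) run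

decreasing⇒run : ∀ C → SlopesDecreasing C → Cap.Run C
decreasing⇒run []              _         = tt
decreasing⇒run (_ ∷ [])        _         = tt
decreasing⇒run (_ ∷ _ ∷ [])    _         = tt
decreasing⇒run (_ ∷ _ ∷ _ ∷ C) (gt , dec) = gt , decreasing⇒run (_ ∷ _ ∷ C) dec

run⇒decreasing : ∀ C → Cap.Run C → SlopesDecreasing C
run⇒decreasing []              _         = tt
run⇒decreasing (_ ∷ [])        _         = tt
run⇒decreasing (_ ∷ _ ∷ [])    _         = tt
run⇒decreasing (_ ∷ _ ∷ _ ∷ C) (gt , run) = gt , run⇒decreasing (_ ∷ _ ∷ C) run

hasCup⇒hasRun : HasCup m P → Cup.HasRun m P
hasCup⇒hasRun (C , C∈ , len , inc , s) = C , C∈ , len , inc , increasing⇒run C s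

hasRun⇒hasCup : Cup.HasRun m P → HasCup m P
hasRun⇒hasCup (C , C∈ , len , inc , s) = C , C∈ , len , inc , run⇒increasing C s

hasCap⇒hasRun : HasCap m P → Cap.HasRun m P
hasCap⇒hasRun (C , C∈ , len , inc , s) = C , C∈ , len , inc , decreasing⇒run C s

hasRun⇒hasCap : Cap.HasRun m P → HasCap m P
hasRun⇒hasCap (C , C∈ , len , inc , s) = C , C∈ , len , inc , run⇒decreasing C s

-- The Erdős–Szekeres cups-caps theorem

-- esBound k l is the binomial coefficient C(k + l, k).
esBound : ℕ → ℕ → ℕ
esBound zero    l       = 1
esBound (suc k) zero    = 1
esBound (suc k) (suc l) = esBound k (suc l) ℕ.+ esBound (suc k) l

two-points : AllPairs (λ p q → xc p ≢ xc q) P → 1 < length P →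
  Any (λ a → Any (λ b → a <ₓ b × ⊤) P) P
two-points {p ∷ []} _ (s≤s ())
two-points {p ∷ q ∷ P} ((p≢q ∷ _) ∷ _) _ with ℚ.<-cmp (xc p) (xc q)
... | tri< p<q _ _ = here (there (here (p<q , tt)))
... | tri≈ _ p≡q _ = contradiction p≡q p≢q
... | tri> _ _ q<p = there (here (here (q<p , tt)))

module _ {A : Set} {S : A → Set} (S? : ∀ x → Dec (S x)) where

  length-filter-complement : ∀ xs →
    length (filter S? xs) ℕ.+ length (filter (¬? ∘ S?) xs) ≡ length xs
  length-filter-complement [] = refl
  length-filter-complement (x ∷ xs) with S? x
  ... | yes _ = cong suc (length-filter-complement xs)
  ... | no  _ = trans (ℕ.+-suc _ _) (cong suc (length-filter-complement xs))

generic-filter : {S : Point → Set} (S? : ∀ p → Dec (S p)) → Generic P → Generic (filter S? P)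
generic-filter S? (distinct , nc) =
  AllPairs.filter⁺ S? distinct ,
  λ p q r p∈ q∈ r∈ → nc p q r (sub p∈) (sub q∈) (sub r∈)
  where
  sub : p ∈ filter S? P → p ∈ P
  sub = proj₁ ∘ ∈-filter⁻ S?

module EndsOfCups (k : ℕ) (P : List Point) where

  -- The cup ending at `b` has `k + 2` points, one fewer than the cups sought in the inductive step
  -- for `suc k`.
  EndsCup : Point → Set
  EndsCup b = Any (λ a → a <ₓ b × Cup.LeftExt P k a b) P

  endsCup? : ∀ b → Dec (EndsCup b)
  endsCup? b = any? (λ a → (xc a ℚ.<? xc b) ×-dec Cup.leftExt? slopeLt? P k a b) P

  ends others : List Point
  ends   = filter endsCup? P
  others = filter (¬? ∘ endsCup?) P

  ends⊆ : p ∈ ends → p ∈ P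
  ends⊆ = proj₁ ∘ ∈-filter⁻ endsCup?

  others⊆ : p ∈ others → p ∈ P
  others⊆ = proj₁ ∘ ∈-filter⁻ (¬? ∘ endsCup?)

  -- The pigeonhole step that matches Pascal's rule in `esBound`.
  others-large : m ℕ.+ n < length P → ¬ n < length ends → m < length others
  others-large {m} {n} large ends≮ = ℕ.≰⇒> λ others≤m → ℕ.<⇒≱ large (begin
    length P                      ≡⟨ length-filter-complement endsCup? P ⟨
    length ends ℕ.+ length others ≤⟨ ℕ.+-mono-≤ (ℕ.≮⇒≥ ends≮) others≤m ⟩
    n ℕ.+ m                       ≡⟨ ℕ.+-comm n m ⟩
    m ℕ.+ n                       ∎)
    where open ℕ.≤-Reasoning

  -- The last point of such a cup ends the same cup in `P`, and was therefore filtered out.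
  others-no-cup : ¬ Cup.LeftRun k others
  others-no-cup run =
    let a , a∈ , run′ = find run
        b , b∈ , a<b , cup = find run′
    in proj₂ (∈-filter⁻ (¬? ∘ endsCup?) {xs = P} b∈)
             (lose (others⊆ a∈) (a<b , Cup.LeftExt-mono k others⊆ cup))

  -- Let a b be the last edge of a cup and b c the first edge of a cap. Then either c prolongs the
  -- cup or a prolongs the cap.
  glue : Generic P → Cap.RightRun l ends → Cup.LeftRun (suc k) P ⊎ Cap.RightRun (suc l) P
  glue {l} gen run =
    let b , b∈ends , run′ = find run
        c , c∈ends , b<c , cap = find run′
        b∈ , endsCup = ∈-filter⁻ endsCup? {xs = P} b∈ends
        a , a∈ , a<b , cup = find endsCup
        c∈ = ends⊆ c∈ends
    in [ (λ lt → inj₁ (lose b∈ (lose c∈ (b<c , lose a∈ (a<b , lt , cup)))))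
       , (λ gt → inj₂ (lose a∈ (lose b∈ (a<b ,
                   lose c∈ (b<c , gt , Cap.RightExt-mono l ends⊆ cap)))))
       ]′ (turn gen a∈ b∈ c∈ a<b b<c)

-- Induction along Pascal's rule: either `ends` exceeds the bound with `l` lowered, or `others` the
-- one with `k` lowered. In the first case `glue` makes up for the cap that is one point short; in
-- the second `others-no-cup` leaves only the cap.
erdős-szekeres : ∀ k l P → Generic P → esBound k l < length P → Cup.LeftRun k P ⊎ Cap.RightRun l P
-- At index 0 a single edge is enough, and two points with distinct x-coordinates supply it.
erdős-szekeres zero    l       P gen large = inj₁ (two-points (proj₁ gen) large)
erdős-szekeres (suc k) zero    P gen large = inj₂ (two-points (proj₁ gen) large)
erdős-szekeres (suc k) (suc l) P gen large
  with esBound (suc k) l ℕ.<? length (EndsOfCups.ends k P)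
... | yes ends-large =
  [ inj₁ ∘ Cup.LeftRun-mono ends⊆ , glue gen ]′
    (erdős-szekeres (suc k) l ends (generic-filter endsCup? gen) ends-large)
  where open EndsOfCups k P
... | no ends≮ =
  [ (λ run → contradiction run others-no-cup) , inj₂ ∘ Cap.RightRun-mono others⊆ ]′
    (erdős-szekeres k (suc l) others (generic-filter (¬? ∘ endsCup?) gen)
      (others-large large ends≮))
  where open EndsOfCups k P

cupCapFree⇒length≤10 : ∀ P → CupCapFree 4 5 P → length P ≤ 10
cupCapFree⇒length≤10 P (gen , no-cup , no-cap) = ℕ.≮⇒≥ λ large →
  [ no-cup ∘ hasRun⇒hasCup ∘ Cup.leftRun⇒hasRun , no-cap ∘ hasRun⇒hasCap ∘ Cap.rightRun⇒hasRun ]′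
    -- `esBound 2 3` evaluates to the binomial coefficient C(5, 2) = 10.
    (erdős-szekeres 2 3 P gen large)

-- Prolonging sets of at most seven points

AllPairs-resp-↭ : {A : Set} {_~_ : A → A → Set} {xs ys : List A} → (∀ {x y} → x ~ y → y ~ x) →
  xs ↭ ys → AllPairs _~_ xs → AllPairs _~_ ys
AllPairs-resp-↭ ~-sym Perm.refl         ps = ps
AllPairs-resp-↭ ~-sym (Perm.prep _ xs↭) (x~ ∷ ps) =
  All-resp-↭ xs↭ x~ ∷ AllPairs-resp-↭ ~-sym xs↭ ps
AllPairs-resp-↭ ~-sym (Perm.swap _ _ xs↭) ((x~y ∷ x~) ∷ y~ ∷ ps) =
  (~-sym x~y ∷ All-resp-↭ xs↭ y~) ∷ All-resp-↭ xs↭ x~ ∷ AllPairs-resp-↭ ~-sym xs↭ ps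
AllPairs-resp-↭ ~-sym (Perm.trans xs↭ ys↭) ps =
  AllPairs-resp-↭ ~-sym ys↭ (AllPairs-resp-↭ ~-sym xs↭ ps)

generic-↭ : P ↭ Q → Generic P → Generic Q
generic-↭ {P} {Q} P↭Q (distinct , nc) =
  AllPairs-resp-↭ ≢-sym P↭Q distinct ,
  λ p q r p∈ q∈ r∈ → nc p q r (back p∈) (back q∈) (back r∈)
  where
  back : p ∈ Q → p ∈ P
  back = ∈-resp-↭ (↭-sym P↭Q)

hasCup-↭ : P ↭ Q → HasCup m P → HasCup m Q
hasCup-↭ P↭Q (C , C∈ , cup) = C , All.map (∈-resp-↭ P↭Q) C∈ , cup

hasCap-↭ : P ↭ Q → HasCap m P → HasCap m Q
hasCap-↭ P↭Q (C , C∈ , cap) = C , All.map (∈-resp-↭ P↭Q) C∈ , cap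

saturated-↭ : P ↭ Q → CupCapSaturated k l P → CupCapSaturated k l Q
saturated-↭ P↭Q ((gen , no-cup , no-cap) , sat) =
  (generic-↭ P↭Q gen , no-cup ∘ hasCup-↭ Q↭P , no-cap ∘ hasCap-↭ Q↭P) ,
  λ q q∉ gen-q →
    [ inj₁ ∘ hasCup-↭ (Perm.prep q P↭Q) , inj₂ ∘ hasCap-↭ (Perm.prep q P↭Q) ]′
      (sat q (q∉ ∘ ∈-resp-↭ P↭Q) (generic-↭ (Perm.prep q Q↭P) gen-q))
  where
  Q↭P = ↭-sym P↭Q

-- Sorting yields only weak inequalities between x-coordinates; genericity makes them strict.
sort-generic : Generic P → ∃[ Q ] (P ↭ Q × AllPairs _<ₓ_ Q)
sort-generic {P} (distinct , _) =
  sort P , P↭ ,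
  AllPairs.zipWith (λ (x≤y , x≢y) → ≤∧≢⇒< x≤y x≢y)
    (Sorted⇒AllPairs (DecTotalOrder.totalOrder order) (sort-↗ P) ,
     AllPairs-resp-↭ ≢-sym P↭ distinct)
  where
  order = On.decTotalOrder ℚ.≤-decTotalOrder xc
  open Sort order
  P↭ = ↭-sym (sort-↭ P)

xIncreasing⇒allPairs : ∀ C → XIncreasing C → AllPairs _<ₓ_ C
xIncreasing⇒allPairs C = Linked⇒AllPairs (λ {p} {q} {r} → <ₓ-trans {p} {q} {r}) ∘ linked C
  where
  linked : ∀ C → XIncreasing C → Linked _<ₓ_ C
  linked []          _           = []
  linked (_ ∷ [])    _           = [-]
  linked (_ ∷ _ ∷ C) (p<q , inc) = p<q ∷ linked (_ ∷ C) inc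

∈-tail : p ∈ q ∷ P → xc p ≢ xc q → p ∈ P
∈-tail (here refl) p≢q = contradiction refl p≢q
∈-tail (there p∈)  _   = p∈

-- If the heads agree, the later points of `C` lie strictly to the right and hence in the tail of
-- `P`; otherwise the head of `P` lies left of all of `C` and is skipped. Thus cups and caps in a
-- sorted list are subsequences of it.
increasing⇒sublist : AllPairs _<ₓ_ C → AllPairs _<ₓ_ P → All (_∈ P) C → C ⊆ P
increasing⇒sublist []          _           _ = minimum _
increasing⇒sublist (c< ∷ incC) (p< ∷ incP) (here refl ∷ C∈) =
  refl ∷ increasing⇒sublist incC incP
           (All.zipWith (λ (p<c , c∈) → ∈-tail c∈ (≢-sym (ℚ.<⇒≢ p<c))) (c< , C∈))
increasing⇒sublist {C = c ∷ C} {P = p ∷ P} (c< ∷ incC) (p< ∷ incP) (there c∈ ∷ C∈) =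
  p ∷ʳ increasing⇒sublist (c< ∷ incC) incP
         (c∈ ∷ All.zipWith
           (λ {r} (c<r , r∈) → ∈-tail r∈ (≢-sym (ℚ.<⇒≢ (<ₓ-trans {p} {c} {r} p<c c<r))))
           (c< , C∈))
  where
  p<c = All.lookup p< c∈

module _ (R : Point → Point → Point → Set) where
  open Runs R

  run-⊆ : AllPairs _<ₓ_ P → (run : HasRun m P) → proj₁ run ⊆ P
  run-⊆ incP (C , C∈ , _ , inc , _) = increasing⇒sublist (xIncreasing⇒allPairs C inc) incP C∈

  no-long-run : AllPairs _<ₓ_ P → length P < m → ¬ HasRun m P
  no-long-run incP P<m run@(_ , _ , refl , _) = ℕ.<⇒≱ P<m (length-mono-≤ (run-⊆ incP run))

  -- A subsequence of full length is the whole list, so the turns at consecutive points decide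
  -- whether all points together form a run.
  full-run : AllPairs _<ₓ_ P → HasRun (length P) P → Run P
  full-run incP run@(C , _ , len , _ , run-C) =
    subst Run (Pointwise-≡⇒≡ (toPointwise len (run-⊆ incP run))) run-C

-- A new point over a gap, far below or far above.

gap : ∀ P Q → AllPairs _<ₓ_ (P ++ Q) →
  ∃[ x ] (All (λ p → xc p ℚ.< x) P × All (λ p → x ℚ.< xc p) Q)
gap [] []       _            = 0ℚ , [] , []
gap [] (q ∷ Q)  (q< ∷ _)     =
  let x , x<q = ℚ-unbounded-below (xc q)
  in x , [] , x<q ∷ All.map (ℚ.<-trans x<q) q<
gap (p ∷ []) [] _            =
  let x , p<x = ℚ-unbounded-above (xc p) in x , p<x ∷ [] , []
gap (p ∷ []) (q ∷ Q) ((p<q ∷ _) ∷ q< ∷ _) =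
  let x , p<x , x<q = ℚ.<-dense p<q
  in x , p<x ∷ [] , x<q ∷ All.map (ℚ.<-trans x<q) q<
gap (p ∷ p′ ∷ P) Q ((p<p′ ∷ _) ∷ inc) with gap (p′ ∷ P) Q inc
... | x , p′<x ∷ P<x , x<Q = x , ℚ.<-trans p<p′ p′<x ∷ p′<x ∷ P<x , x<Q

-- That is, for all sufficiently low values. With explicit thresholds, finitely many such conditions
-- are met at once below the minimum.
Eventually : (ℚ → Set) → Set
Eventually φ = ∃[ B ] (∀ y → y ℚ.< B → φ y)

eventually-all : {A : Set} {φ : A → ℚ → Set} (xs : List A) → (∀ {x} → x ∈ xs → Eventually (φ x)) →
  Eventually (λ y → ∀ {x} → x ∈ xs → φ x y)
eventually-all []       ev = 0ℚ , λ _ _ ()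
eventually-all (x ∷ xs) ev =
  let B , φ-x  = ev (here refl)
      D , φ-xs = eventually-all xs (ev ∘ there)
  in B ℚ.⊓ D , λ where
       y y< (here refl) → φ-x y (ℚ.<-≤-trans y< (ℚ.p⊓q≤p B D))
       y y< (there x∈)  → φ-xs y (ℚ.<-≤-trans y< (ℚ.p⊓q≤q B D)) x∈

eventually-pairs : {φ : Point → Point → ℚ → Set} (P : List Point) →
  (∀ a b → a <ₓ b → Eventually (φ a b)) →
  ∃[ y ] (∀ {a b} → a ∈ P → b ∈ P → a <ₓ b → φ a b y)
eventually-pairs {φ} P ev =
  let B , φ-P = eventually-all P λ {a} _ → eventually-all P λ {b} _ → one a b
      y , y<B = ℚ-unbounded-below B
  in y , λ a∈ b∈ → φ-P y y<B a∈ b∈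
  where
  one : ∀ a b → Eventually (λ y → a <ₓ b → φ a b y)
  one a b with xc a ℚ.<? xc b
  ... | yes a<b = let B , φ-ab = ev a b a<b in B , λ y y<B _ → φ-ab y y<B
  ... | no  a≮b = 0ℚ , λ _ _ a<b → contradiction a<b a≮b

-- B is the height of the line through a and b over x.
eventually-below : ∀ x a b → a <ₓ b → Eventually (λ y → 0ℚ ℚ.< det b a (x , y))
eventually-below x a b a<b = B , λ y y<B →
  subst (0ℚ ℚ.<_) (factor y) (*-pos (x<y⇒0<y-x y<B) 0<w)
  where
  w = xc b - xc a
  0<w = x<y⇒0<y-x a<b
  instance
    w≢0 : ℚ.NonZero w
    w≢0 = ℚ.pos⇒nonZero w {{positive 0<w}}
  B = yc a + (yc b - yc a) * (x - xc a) * 1/ w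
  -- The vertical distance to the line times the width `w` of the pair; multiplying by `w` cancels
  -- the inverse in `B`.
  factor : ∀ y → (B - y) * w ≡ det b a (x , y)
  factor y = begin
    (B - y) * w
      ≡⟨ solve 5 (λ ya e w i y → (ya :+ e :* i :- y) :* w := (ya :- y) :* w :+ e :* (i :* w)) refl
           (yc a) ((yc b - yc a) * (x - xc a)) w (1/ w) y ⟩
    (yc a - y) * w + (yc b - yc a) * (x - xc a) * (1/ w * w)
      ≡⟨ cong (λ i → (yc a - y) * w + (yc b - yc a) * (x - xc a) * i) (ℚ.*-inverseˡ w) ⟩
    (yc a - y) * w + (yc b - yc a) * (x - xc a) * 1ℚ
      ≡⟨ solve 6 (λ xa ya xb yb x y →
           (ya :- y) :* (xb :- xa) :+ (yb :- ya) :* (x :- xa) :* con 1ℚ :=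
           (y :- ya) :* (xa :- xb) :- (ya :- yb) :* (x :- xa)) refl
           (xc a) (yc a) (xc b) (yc b) x y ⟩
    det b a (x , y) ∎
    where open ≡-Reasoning

-- Reflection in the x-axis reduces this to `eventually-below`: it reverses orientations, and
-- exchanging `a` and `b` undoes that.
eventually-above : ∀ x a b → a <ₓ b → Eventually (λ y → 0ℚ ℚ.< det a b (x , - y))
eventually-above x a b a<b =
  let B , below = eventually-below x (mirror a) (mirror b) a<b
  in B , λ y y<B → subst (0ℚ ℚ.<_) (mirrored y) (below y y<B)
  where
  mirror : Point → Point
  mirror p = xc p , - yc p
  mirrored : ∀ y → det (mirror b) (mirror a) (x , y) ≡ det a b (x , - y)
  mirrored y = solve 6 (λ xa ya xb yb x y →
    (y :- (:- ya)) :* (xa :- xb) :- (:- ya :- (:- yb)) :* (x :- xa) :=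
    (:- y :- yb) :* (xb :- xa) :- (yb :- ya) :* (x :- xb)) refl (xc a) (yc a) (xc b) (yc b) x y

-- A point q is extremal over P if it lies below all lines through two points of P (then R and R′
-- are SlopeLt and SlopeGt), or above all of them (then the roles are exchanged).
record Extremal (R R′ : Point → Point → Point → Set) (P : List Point) (q : Point) : Set where
  field
    first  : ∀ {a b} → a ∈ P → b ∈ P → a <ₓ b → R′ q a b
    middle : ∀ {a b} → a ∈ P → b ∈ P → a <ₓ b → R a q b
    last   : ∀ {a b} → a ∈ P → b ∈ P → a <ₓ b → R′ a b q

-- The three fields come from the single inequality `0 < det b a apex` by cyclic rotation, whatever
-- the place of `x` among the x-coordinates.
low-point : ∀ P x → ∃[ y ] Extremal SlopeLt SlopeGt P (x , y)
low-point P x = height , record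
  { first  = λ {a} {b} a∈ b∈ a<b → slopeGt⁺ apex a b (below a∈ b∈ a<b)
  ; middle = λ {a} {b} a∈ b∈ a<b → slopeLt⁺ a apex b
      (subst (0ℚ ℚ.<_) (det-rotate b a apex) (below a∈ b∈ a<b))
  ; last   = λ {a} {b} a∈ b∈ a<b → slopeGt⁺ a b apex
      (subst (0ℚ ℚ.<_) (sym (det-rotate apex b a)) (below a∈ b∈ a<b))
  }
  where
  choice = eventually-pairs P (eventually-below x)
  height = proj₁ choice
  apex = x , height
  below = proj₂ choice

high-point : ∀ P x → ∃[ y ] Extremal SlopeGt SlopeLt P (x , y)
high-point P x = - height , record
  { first  = λ {a} {b} a∈ b∈ a<b → slopeLt⁺ apex a b
      (subst (0ℚ ℚ.<_) (sym (det-rotate apex a b)) (above a∈ b∈ a<b))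
  ; middle = λ {a} {b} a∈ b∈ a<b → slopeGt⁺ a apex b
      (subst (0ℚ ℚ.<_) (sym (trans (det-rotate b apex a) (det-rotate apex a b))) (above a∈ b∈ a<b))
  ; last   = λ {a} {b} a∈ b∈ a<b → slopeLt⁺ a b apex (above a∈ b∈ a<b)
  }
  where
  choice = eventually-pairs P (eventually-above x)
  height = proj₁ choice
  apex = x , - height
  above = proj₂ choice

slopeLt⇒¬slopeGt : ∀ p q r → SlopeLt p q r → ¬ SlopeGt p q r
slopeLt⇒¬slopeGt _ _ _ = ℚ.<-asym

slopeGt⇒¬slopeLt : ∀ p q r → SlopeGt p q r → ¬ SlopeLt p q r
slopeGt⇒¬slopeLt _ _ _ = ℚ.<-asym

module Prolong (R R′ : Point → Point → Point → Set)
               (exclusive : ∀ p q r → R p q r → ¬ R′ p q r)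
               {L M : List Point} {q : Point} (extremal : Extremal R R′ (L ++ M) q)
               (L<q : All (_<ₓ q) L) (q<M : All (q <ₓ_) M) where
  open Extremal extremal
  open Runs

  ∈-right : q <ₓ p → p ∈ q ∷ L ++ M → p ∈ L ++ M
  ∈-right q<p p∈ = ∈-tail p∈ (≢-sym (ℚ.<⇒≢ q<p))

  ∈-left : p <ₓ q → p ∈ q ∷ L ++ M → p ∈ L ++ M
  ∈-left p<q p∈ = ∈-tail p∈ (ℚ.<⇒≢ p<q)

  ∈-L : p <ₓ q → p ∈ L ++ M → p ∈ L
  ∈-L p<q p∈ = [ (λ p∈L → p∈L)
               , (λ p∈M → contradiction p<q (ℚ.<-asym (All.lookup q<M p∈M))) ]′ (∈-++⁻ L p∈)

  ∈-M : q <ₓ p → p ∈ L ++ M → p ∈ M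
  ∈-M q<p p∈ = [ (λ p∈L → contradiction q<p (ℚ.<-asym (All.lookup L<q p∈L)))
               , (λ p∈M → p∈M) ]′ (∈-++⁻ L p∈)

  R-first : a ∈ q ∷ L ++ M → b ∈ q ∷ L ++ M → c ∈ q ∷ L ++ M →
    a <ₓ b → b <ₓ c → R a b c → a ∈ L ++ M
  R-first {a} {b} {c} (here refl) b∈ c∈ a<b b<c Rabc =
    contradiction (first (∈-right a<b b∈) (∈-right (<ₓ-trans {a} {b} {c} a<b b<c) c∈) b<c)
                  (exclusive a b c Rabc)
  R-first (there a∈) _ _ _ _ _ = a∈

  R-last : a ∈ q ∷ L ++ M → b ∈ q ∷ L ++ M → c ∈ q ∷ L ++ M →
    a <ₓ b → b <ₓ c → R a b c → c ∈ L ++ M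
  R-last {a} {b} {c} a∈ b∈ (here refl) a<b b<c Rabc =
    contradiction (last (∈-left (<ₓ-trans {a} {b} {c} a<b b<c) a∈) (∈-left b<c b∈) a<b)
                  (exclusive a b c Rabc)
  R-last _ _ (there c∈) _ _ _ = c∈

  R′-middle : a ∈ q ∷ L ++ M → b ∈ q ∷ L ++ M → c ∈ q ∷ L ++ M →
    a <ₓ b → b <ₓ c → R′ a b c → b ∈ L ++ M
  R′-middle {a} {b} {c} a∈ (here refl) c∈ a<b b<c R′abc =
    contradiction R′abc (exclusive a b c
      (middle (∈-left a<b a∈) (∈-right b<c c∈) (<ₓ-trans {a} {b} {c} a<b b<c)))
  R′-middle _ (there b∈) _ _ _ _ = b∈

  -- In an `R`-triple `q` can only be the middle point, since `first` and `last` give the excluded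
  -- relation. Every point of a run of four is first or last in some consecutive triple, so `q` does
  -- not occur.
  R-run₄ : HasRun R 4 (q ∷ L ++ M) → HasRun R 4 (L ++ M)
  R-run₄ (C@(_ ∷ _ ∷ _ ∷ _ ∷ []) , a∈ ∷ b∈ ∷ c∈ ∷ d∈ ∷ [] , len ,
          inc@(a<b , b<c , c<d , _) , run@(abc , bcd , _)) =
    C ,
    R-first a∈ b∈ c∈ a<b b<c abc ∷ R-first b∈ c∈ d∈ b<c c<d bcd ∷
    R-last a∈ b∈ c∈ a<b b<c abc ∷ R-last b∈ c∈ d∈ b<c c<d bcd ∷ [] ,
    len , inc , run

  R-run₅ : HasRun R 5 (q ∷ L ++ M) → HasRun R 5 (L ++ M)
  R-run₅ (C@(_ ∷ _ ∷ _ ∷ _ ∷ _ ∷ []) , a∈ ∷ b∈ ∷ c∈ ∷ d∈ ∷ e∈ ∷ [] , len ,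
          inc@(a<b , b<c , c<d , d<e , _) , run@(abc , bcd , cde , _)) =
    C ,
    R-first a∈ b∈ c∈ a<b b<c abc ∷ R-first b∈ c∈ d∈ b<c c<d bcd ∷
    R-last a∈ b∈ c∈ a<b b<c abc ∷ R-last b∈ c∈ d∈ b<c c<d bcd ∷
    R-last c∈ d∈ e∈ c<d d<e cde ∷ [] ,
    len , inc , run

  -- In an `R′`-triple `q` is never the middle point, so it can only be an end of the run; the other
  -- three points then lie on one side of it.
  R′-run₄ : HasRun R′ 4 (q ∷ L ++ M) → HasRun R′ 4 (L ++ M) ⊎ HasRun R′ 3 L ⊎ HasRun R′ 3 M
  R′-run₄ (C@(a ∷ b ∷ c ∷ d ∷ []) , a∈ ∷ b∈ ∷ c∈ ∷ d∈ ∷ [] , len ,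
           inc@(a<b , b<c , c<d , _) , run@(abc , bcd , _)) = cases a∈ d∈
    where
    b∈P = R′-middle a∈ b∈ c∈ a<b b<c abc
    c∈P = R′-middle b∈ c∈ d∈ b<c c<d bcd
    a<c = <ₓ-trans {a} {b} {c} a<b b<c
    b<d = <ₓ-trans {b} {c} {d} b<c c<d
    a<d = <ₓ-trans {a} {b} {d} a<b b<d
    cases : a ∈ q ∷ L ++ M → d ∈ q ∷ L ++ M → _
    cases (here refl) _ = inj₂ (inj₂ (_ ∷ _ ∷ _ ∷ [] ,
      ∈-M a<b b∈P ∷ ∈-M a<c c∈P ∷ ∈-M a<d (∈-right a<d d∈) ∷ [] ,
      refl , (b<c , c<d , tt) , bcd , tt))
    cases (there a∈P) (here refl) = inj₂ (inj₁ (_ ∷ _ ∷ _ ∷ [] ,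
      ∈-L a<d a∈P ∷ ∈-L b<d b∈P ∷ ∈-L c<d c∈P ∷ [] , refl , (a<b , b<c , tt) , abc , tt))
    cases (there a∈P) (there d∈P) = inj₁ (C , a∈P ∷ b∈P ∷ c∈P ∷ d∈P ∷ [] , len , inc , run)

  R′-run₅ : HasRun R′ 5 (q ∷ L ++ M) → HasRun R′ 5 (L ++ M) ⊎ HasRun R′ 4 L ⊎ HasRun R′ 4 M
  R′-run₅ (C@(a ∷ b ∷ c ∷ d ∷ e ∷ []) , a∈ ∷ b∈ ∷ c∈ ∷ d∈ ∷ e∈ ∷ [] , len ,
           inc@(a<b , b<c , c<d , d<e , _) , run@(abc , bcd , cde , _)) = cases a∈ e∈
    where
    b∈P = R′-middle a∈ b∈ c∈ a<b b<c abc
    c∈P = R′-middle b∈ c∈ d∈ b<c c<d bcd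
    d∈P = R′-middle c∈ d∈ e∈ c<d d<e cde
    a<c = <ₓ-trans {a} {b} {c} a<b b<c
    a<d = <ₓ-trans {a} {c} {d} a<c c<d
    c<e = <ₓ-trans {c} {d} {e} c<d d<e
    b<e = <ₓ-trans {b} {c} {e} b<c c<e
    a<e = <ₓ-trans {a} {b} {e} a<b b<e
    cases : a ∈ q ∷ L ++ M → e ∈ q ∷ L ++ M → _
    cases (here refl) _ = inj₂ (inj₂ (_ ∷ _ ∷ _ ∷ _ ∷ [] ,
      ∈-M a<b b∈P ∷ ∈-M a<c c∈P ∷ ∈-M a<d d∈P ∷ ∈-M a<e (∈-right a<e e∈) ∷ [] ,
      refl , (b<c , c<d , d<e , tt) , bcd , cde , tt))
    cases (there a∈P) (here refl) = inj₂ (inj₁ (_ ∷ _ ∷ _ ∷ _ ∷ [] ,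
      ∈-L a<e a∈P ∷ ∈-L b<e b∈P ∷ ∈-L c<e c∈P ∷ ∈-L d<e d∈P ∷ [] ,
      refl , (a<b , b<c , c<d , tt) , abc , bcd , tt))
    cases (there a∈P) (there e∈P) =
      inj₁ (C , a∈P ∷ b∈P ∷ c∈P ∷ d∈P ∷ e∈P ∷ [] , len , inc , run)

  q∉ : q ∉ L ++ M
  q∉ q∈ = [ (λ q∈L → ℚ.<-irrefl refl (All.lookup L<q q∈L))
          , (λ q∈M → ℚ.<-irrefl refl (All.lookup q<M q∈M)) ]′ (∈-++⁻ L q∈)

  -- By `extremal` every triple with `q` is a strict turn of one kind or the other, which rules out
  -- collinearity.
  generic-∷ : (∀ p q r → R p q r → ¬ Collinear p q r) → (∀ p q r → R′ p q r → ¬ Collinear p q r) →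
    Generic (L ++ M) → Generic (q ∷ L ++ M)
  generic-∷ R⇒nc R′⇒nc (distinct , nc) =
    All.++⁺ (All.map (≢-sym ∘ ℚ.<⇒≢) L<q) (All.map ℚ.<⇒≢ q<M) ∷ distinct , nc′
    where
    nc′ : ∀ a b c → a ∈ q ∷ L ++ M → b ∈ q ∷ L ++ M → c ∈ q ∷ L ++ M →
      a <ₓ b → b <ₓ c → ¬ Collinear a b c
    nc′ a b c (here refl) b∈ c∈ a<b b<c =
      R′⇒nc a b c (first (∈-right a<b b∈) (∈-right (<ₓ-trans {a} {b} {c} a<b b<c) c∈) b<c)
    nc′ a b c (there a∈) (here refl) c∈ a<b b<c =
      R⇒nc a b c (middle a∈ (∈-right b<c c∈) (<ₓ-trans {a} {b} {c} a<b b<c))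
    nc′ a b c (there a∈) (there b∈) (here refl) a<b b<c = R′⇒nc a b c (last a∈ b∈ a<b)
    nc′ a b c (there a∈) (there b∈) (there c∈) = nc a b c a∈ b∈ c∈

slopeLt⇒¬collinear : ∀ p q r → SlopeLt p q r → ¬ Collinear p q r
slopeLt⇒¬collinear p q r lt =
  ℚ.<⇒≢ (slopeLt⁻ p q r lt) ∘ sym ∘ collinear⇒det≡0 p q r

slopeGt⇒¬collinear : ∀ p q r → SlopeGt p q r → ¬ Collinear p q r
slopeGt⇒¬collinear p q r gt coll =
  ℚ.<⇒≢ (slopeGt⁻ p q r gt) (sym (trans (det-reverse p q r) (cong -_ (collinear⇒det≡0 p q r coll))))

-- A point below all lines only lengthens caps, and only as their first or last point.
prolong-low : ∀ L M → AllPairs _<ₓ_ (L ++ M) → ¬ Cap.HasRun 4 L → ¬ Cap.HasRun 4 M →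
  ¬ CupCapSaturated 4 5 (L ++ M)
prolong-low L M inc no-L no-M ((gen , no-cup , no-cap) , sat) =
  let x , L<x , x<M = gap L M inc
      y , extremal  = low-point (L ++ M) x
      open Prolong SlopeLt SlopeGt slopeLt⇒¬slopeGt extremal L<x x<M
  in [ no-cup ∘ hasRun⇒hasCup ∘ R-run₄ ∘ hasCup⇒hasRun
     , [ no-cap ∘ hasRun⇒hasCap , [ no-L , no-M ]′ ]′ ∘ R′-run₅ ∘ hasCap⇒hasRun
     ]′ (sat (x , y) q∉ (generic-∷ slopeLt⇒¬collinear slopeGt⇒¬collinear gen))

-- A point above all lines can only be an end of a 4-cup, which leaves a 3-cup on one side of it,
-- and it lies on no 5-cap.
prolong-high : ∀ L M → AllPairs _<ₓ_ (L ++ M) → ¬ Cup.HasRun 3 L → ¬ Cup.HasRun 3 M →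
  ¬ CupCapSaturated 4 5 (L ++ M)
prolong-high L M inc no-L no-M ((gen , no-cup , no-cap) , sat) =
  let x , L<x , x<M = gap L M inc
      y , extremal  = high-point (L ++ M) x
      open Prolong SlopeGt SlopeLt slopeGt⇒¬slopeLt extremal L<x x<M
  in [ [ no-cup ∘ hasRun⇒hasCup , [ no-L , no-M ]′ ]′ ∘ R′-run₄ ∘ hasCup⇒hasRun
     , no-cap ∘ hasRun⇒hasCap ∘ R-run₅ ∘ hasCap⇒hasRun
     ]′ (sat (x , y) q∉ (generic-∷ slopeGt⇒¬collinear slopeLt⇒¬collinear gen))

-- Multiplied by the positive width of `b c`, the determinants of the two new triples are
-- combinations of those of `a b c` and `b c d`, with positive widths as coefficients.
cap-skip : ∀ a b c d → a <ₓ b → b <ₓ c → c <ₓ d → SlopeGt a b c → SlopeGt b c d →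
  SlopeGt a b d × SlopeGt a c d
cap-skip a b c d a<b b<c c<d abc bcd =
  slopeGt⁺ a b d (*-cancelʳ-pos 0<bc (subst (0ℚ ℚ.<_) (sym (abd a b c d))
    (+-pos (*-pos 0<abc (x<y⇒0<y-x b<d)) (*-pos 0<bcd (x<y⇒0<y-x a<b))))) ,
  slopeGt⁺ a c d (*-cancelʳ-pos 0<bc (subst (0ℚ ℚ.<_) (sym (acd a b c d))
    (+-pos (*-pos 0<abc (x<y⇒0<y-x c<d)) (*-pos 0<bcd (x<y⇒0<y-x a<c)))))
  where
  a<c = <ₓ-trans {a} {b} {c} a<b b<c
  b<d = <ₓ-trans {b} {c} {d} b<c c<d
  0<bc = x<y⇒0<y-x b<c
  0<abc = slopeGt⁻ a b c abc
  0<bcd = slopeGt⁻ b c d bcd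
  abd : ∀ a b c d → det d b a * (xc c - xc b) ≡
    det c b a * (xc d - xc b) + det d c b * (xc b - xc a)
  abd (a₁ , a₂) (b₁ , b₂) (c₁ , c₂) (d₁ , d₂) = solve 8 (λ a₁ a₂ b₁ b₂ c₁ c₂ d₁ d₂ →
    ((a₂ :- b₂) :* (b₁ :- d₁) :- (b₂ :- d₂) :* (a₁ :- b₁)) :* (c₁ :- b₁) :=
    ((a₂ :- b₂) :* (b₁ :- c₁) :- (b₂ :- c₂) :* (a₁ :- b₁)) :* (d₁ :- b₁) :+
    ((b₂ :- c₂) :* (c₁ :- d₁) :- (c₂ :- d₂) :* (b₁ :- c₁)) :* (b₁ :- a₁))
    refl a₁ a₂ b₁ b₂ c₁ c₂ d₁ d₂
  acd : ∀ a b c d → det d c a * (xc c - xc b) ≡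
    det c b a * (xc d - xc c) + det d c b * (xc c - xc a)
  acd (a₁ , a₂) (b₁ , b₂) (c₁ , c₂) (d₁ , d₂) = solve 8 (λ a₁ a₂ b₁ b₂ c₁ c₂ d₁ d₂ →
    ((a₂ :- c₂) :* (c₁ :- d₁) :- (c₂ :- d₂) :* (a₁ :- c₁)) :* (c₁ :- b₁) :=
    ((a₂ :- b₂) :* (b₁ :- c₁) :- (b₂ :- c₂) :* (a₁ :- b₁)) :* (d₁ :- c₁) :+
    ((b₂ :- c₂) :* (c₁ :- d₁) :- (c₂ :- d₂) :* (b₁ :- c₁)) :* (c₁ :- a₁))
    refl a₁ a₂ b₁ b₂ c₁ c₂ d₁ d₂

-- All four triples are right turns: two by hypothesis, two by `cap-skip`.
4-cap⇒no-3-cup : AllPairs _<ₓ_ (a ∷ b ∷ c ∷ d ∷ []) → Cap.Run (a ∷ b ∷ c ∷ d ∷ []) →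
  ¬ Cup.HasRun 3 (a ∷ b ∷ c ∷ d ∷ [])
4-cap⇒no-3-cup {a} {b} {c} {d}
  inc@((a<b ∷ _) ∷ (b<c ∷ _) ∷ (c<d ∷ _) ∷ _) (abc , bcd , _)
  run@(p ∷ q ∷ r ∷ [] , _ , _ , _ , pqr , _) =
  slopeLt⇒¬slopeGt p q r pqr (triple (run-⊆ SlopeLt inc run))
  where
  skips = cap-skip a b c d a<b b<c c<d abc bcd
  triple : ∀ {p q r} → p ∷ q ∷ r ∷ [] ⊆ a ∷ b ∷ c ∷ d ∷ [] → SlopeGt p q r
  triple (refl ∷ refl ∷ refl ∷ _)      = abc
  triple (refl ∷ refl ∷ _ ∷ʳ refl ∷ _) = proj₁ skips
  triple (refl ∷ _ ∷ʳ refl ∷ refl ∷ _) = proj₂ skips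
  triple (_ ∷ʳ refl ∷ refl ∷ refl ∷ _) = bcd
  -- From here on two of the four points are skipped, which leaves too few for three.
  triple (refl ∷ _ ∷ʳ _ ∷ʳ s) with () ← s≤s⁻¹ (length-mono-≤ s)
  triple (_ ∷ʳ refl ∷ _ ∷ʳ s) with () ← s≤s⁻¹ (length-mono-≤ s)
  triple (_ ∷ʳ _ ∷ʳ s) with () ← s≤s⁻¹ (s≤s⁻¹ (length-mono-≤ s))

¬saturated-7 : ∀ S → length S ≡ 7 → AllPairs _<ₓ_ S → ¬ CupCapSaturated 4 5 S
¬saturated-7 (p₁ ∷ p₂ ∷ p₃ ∷ p₄ ∷ p₅ ∷ p₆ ∷ p₇ ∷ []) refl inc
  with slopeGt? p₁ p₂ p₃ ×-dec slopeGt? p₂ p₃ p₄ | slopeGt? p₄ p₅ p₆ ×-dec slopeGt? p₅ p₆ p₇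
-- The only candidate for a 4-cap among the first four points is their whole list, and the right
-- side has only three points.
... | no ¬cap | _ =
  prolong-low (p₁ ∷ p₂ ∷ p₃ ∷ p₄ ∷ []) (p₅ ∷ p₆ ∷ p₇ ∷ []) inc
    (λ run → ¬cap (let s , t , _ = full-run SlopeGt (AllPairs.take⁺ 4 inc) run in s , t))
    (no-long-run SlopeGt (AllPairs.drop⁺ 4 inc) ℕ.≤-refl)
... | yes _ | no ¬cap =
  prolong-low (p₁ ∷ p₂ ∷ p₃ ∷ []) (p₄ ∷ p₅ ∷ p₆ ∷ p₇ ∷ []) inc
    (no-long-run SlopeGt (AllPairs.take⁺ 3 inc) ℕ.≤-refl)
    (λ run → ¬cap (let s , t , _ = full-run SlopeGt (AllPairs.drop⁺ 3 inc) run in s , t))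
... | yes (s , t) | yes (_ , u) =
  prolong-high (p₁ ∷ p₂ ∷ p₃ ∷ p₄ ∷ []) (p₅ ∷ p₆ ∷ p₇ ∷ []) inc
    (4-cap⇒no-3-cup (AllPairs.take⁺ 4 inc) (s , t , tt))
    (λ run → slopeGt⇒¬slopeLt p₅ p₆ p₇ u (proj₁ (full-run SlopeLt (AllPairs.drop⁺ 4 inc) run)))

¬saturated-≤6 : ∀ S → length S ≤ 6 → AllPairs _<ₓ_ S → ¬ CupCapSaturated 4 5 S
¬saturated-≤6 S S≤6 inc = subst (¬_ ∘ CupCapSaturated 4 5) split
  (prolong-low (take 3 S) (drop 3 S) (subst (AllPairs _<ₓ_) (sym split) inc)
    (no-long-run SlopeGt (AllPairs.take⁺ 3 inc) (s≤s take≤3))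
    (no-long-run SlopeGt (AllPairs.drop⁺ 3 inc) (s≤s drop≤3)))
  where
  split = take++drop≡id 3 S
  take≤3 : length (take 3 S) ≤ 3
  take≤3 = subst (_≤ 3) (sym (length-take 3 S)) (ℕ.m⊓n≤m 3 (length S))
  drop≤3 : length (drop 3 S) ≤ 3
  drop≤3 = subst (_≤ 3) (sym (length-drop 3 S)) (ℕ.∸-monoˡ-≤ 3 S≤6)

-- Saturation does not depend on the order of the list, so the points may be sorted by x.
cupCapSaturated⇒8≤length : ∀ P → CupCapSaturated 4 5 P → 8 ≤ length P
cupCapSaturated⇒8≤length P sat = ℕ.≮⇒≥ λ P<8 →
  let S , P↭S , inc = sort-generic (proj₁ (proj₁ sat))
      S≤7 = subst (_≤ 7) (↭-length P↭S) (s≤s⁻¹ P<8)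
      sat-S = saturated-↭ P↭S sat
  in [ (λ S<7 → ¬saturated-≤6 S (s≤s⁻¹ S<7) inc sat-S)
     , (λ S≡7 → ¬saturated-7 S S≡7 inc sat-S) ]′ (ℕ.m≤n⇒m<n∨m≡n S≤7)

-- Saturation of a set of eight points

det-swap : ∀ p q r → det q p r ≡ - det p q r
det-swap (a , b) (c , d) (e , f) = solve 6 (λ a b c d e f →
  (f :- b) :* (a :- c) :- (b :- d) :* (e :- a) :=
  :- ((f :- d) :* (c :- a) :- (d :- b) :* (e :- c))) refl a b c d e f

det-degenerate : ∀ p q → det p p q ≡ 0ℚ
det-degenerate (a , b) (c , d) = solve 4 (λ a b c d →
  (d :- b) :* (a :- a) :- (b :- b) :* (c :- a) := con 0ℚ) refl a b c d

module _ (gen : Generic P) where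

  private
    sorted : ∀ a b c → a ∈ P → b ∈ P → c ∈ P → a <ₓ b → b <ₓ c → det a b c ≢ 0ℚ
    sorted a b c a∈ b∈ c∈ a<b b<c = proj₂ gen a b c a∈ b∈ c∈ a<b b<c ∘ det≡0⇒collinear a b c

    ordered : ∀ a b c → a ∈ P → b ∈ P → c ∈ P → a <ₓ b → xc a ≢ xc c → xc b ≢ xc c →
      det a b c ≢ 0ℚ
    ordered a b c a∈ b∈ c∈ a<b a≢c b≢c det≡0 with ℚ.<-cmp (xc a) (xc c) | ℚ.<-cmp (xc b) (xc c)
    ... | tri≈ _ a≡c _ | _            = a≢c a≡c
    ... | _            | tri≈ _ b≡c _ = b≢c b≡c
    ... | _            | tri< b<c _ _ = sorted a b c a∈ b∈ c∈ a<b b<c det≡0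
    ... | tri> _ _ c<a | tri> _ _ _   =
      sorted c a b c∈ a∈ b∈ c<a a<b (trans (det-rotate c a b) det≡0)
    ... | tri< a<c _ _ | tri> _ _ c<b = sorted a c b a∈ c∈ b∈ a<c c<b
      (trans (det-rotate a c b) (trans (det-reverse a b c) (cong -_ det≡0)))

  -- `Generic` speaks of triples in increasing order of x; reordering a triple changes `det` at most
  -- in sign.
  generic⇒det≢0 : ∀ a b c → a ∈ P → b ∈ P → c ∈ P →
    xc a ≢ xc b → xc a ≢ xc c → xc b ≢ xc c → det a b c ≢ 0ℚ
  generic⇒det≢0 a b c a∈ b∈ c∈ a≢b a≢c b≢c det≡0 with ℚ.<-cmp (xc a) (xc b)
  ... | tri< a<b _ _ = ordered a b c a∈ b∈ c∈ a<b a≢c b≢c det≡0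
  ... | tri≈ _ a≡b _ = a≢b a≡b
  ... | tri> _ _ b<a = ordered b a c b∈ a∈ c∈ b<a b≢c a≢c
    (trans (det-swap a b c) (cong -_ det≡0))

-- Affine conditions on the unknown point.

Form : Set
Form = ℚ × ℚ × ℚ

-- Differences of x-coordinates and orientations are affine in a point that occurs once, so every
-- hypothesis on the unknown point can read `0 < ⟦ f ⟧ q`.
⟦_⟧ : Form → Point → ℚ
⟦ α , β , γ ⟧ q = α * xc q + β * yc q + γ

_⊕_ : Form → Form → Form
(α , β , γ) ⊕ (α′ , β′ , γ′) = α + α′ , β + β′ , γ + γ′

_⊙_ : ℚ → Form → Form
n ⊙ (α , β , γ) = n * α , n * β , n * γ

combine : List ℕ → List Form → Form
combine (n ∷ ns) (f ∷ fs) = ((+ n / 1) ⊙ f) ⊕ combine ns fs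
combine _        _        = 0ℚ , 0ℚ , 0ℚ

-- A decidable condition, on coefficients alone, under which the first form is at least the second
-- at every point.
_≽_ : Form → Form → Set
(α , β , γ) ≽ (α′ , β′ , γ′) = α ≡ α′ × β ≡ β′ × γ′ ℚ.≤ γ

_≽?_ : ∀ f g → Dec (f ≽ g)
(α , β , γ) ≽? (α′ , β′ , γ′) = (α ℚ.≟ α′) ×-dec ((β ℚ.≟ β′) ×-dec (γ′ ℚ.≤? γ))

side : Point → Point → Form
side a b = yc a - yc b , xc b - xc a , (yc b - yc a) * xc b - yc b * (xc b - xc a)

⟦side⟧ : ∀ a b q → ⟦ side a b ⟧ q ≡ det a b q
⟦side⟧ (a₁ , a₂) (b₁ , b₂) (q₁ , q₂) = solve 6 (λ a₁ a₂ b₁ b₂ q₁ q₂ →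
  (a₂ :- b₂) :* q₁ :+ (b₁ :- a₁) :* q₂ :+ ((b₂ :- a₂) :* b₁ :- b₂ :* (b₁ :- a₁)) :=
  (q₂ :- b₂) :* (b₁ :- a₁) :- (b₂ :- a₂) :* (q₁ :- b₁)) refl a₁ a₂ b₁ b₂ q₁ q₂

-- A vertex of a cup or cap is a known point or the unknown point, which is written nothing.
Vertex : Set
Vertex = Maybe Point

at : Point → Vertex → Point
at = fromMaybe

constant : ℚ → Form
constant γ = 0ℚ , 0ℚ , γ

⟦constant⟧ : ∀ γ q → ⟦ constant γ ⟧ q ≡ γ
⟦constant⟧ γ (q₁ , q₂) =
  solve 3 (λ γ q₁ q₂ → con 0ℚ :* q₁ :+ con 0ℚ :* q₂ :+ γ := γ) refl γ q₁ q₂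

step : Vertex → Vertex → Form
step (just a) (just b) = constant (xc b - xc a)
step (just a) nothing  = 1ℚ , 0ℚ , - xc a
step nothing  (just b) = - 1ℚ , 0ℚ , xc b
step nothing  nothing  = constant 0ℚ

⟦step⟧ : ∀ u v q → ⟦ step u v ⟧ q ≡ xc (at q v) - xc (at q u)
⟦step⟧ (just a) (just b) q         = ⟦constant⟧ _ q
⟦step⟧ (just a) nothing  (q₁ , q₂) =
  solve 3 (λ a q₁ q₂ → con 1ℚ :* q₁ :+ con 0ℚ :* q₂ :+ :- a := q₁ :- a) refl (xc a) q₁ q₂
⟦step⟧ nothing  (just b) (q₁ , q₂) =
  solve 3 (λ b q₁ q₂ → con (- 1ℚ) :* q₁ :+ con 0ℚ :* q₂ :+ b := b :- q₁) refl (xc b) q₁ q₂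
⟦step⟧ nothing  nothing  q         = trans (⟦constant⟧ 0ℚ q) (sym (ℚ.+-inverseʳ (xc q)))

area : Vertex → Vertex → Vertex → Form
area (just a) (just b) (just c) = constant (det a b c)
area (just a) (just b) nothing  = side a b
area (just a) nothing  (just c) = side c a
area nothing  (just b) (just c) = side b c
-- Here the unknown point occurs at least twice, and the triangle is degenerate.
area _        _        _        = constant 0ℚ

⟦area⟧ : ∀ u v w q → ⟦ area u v w ⟧ q ≡ det (at q u) (at q v) (at q w)
⟦area⟧ (just a) (just b) (just c) q = ⟦constant⟧ _ q
⟦area⟧ (just a) (just b) nothing  q = ⟦side⟧ a b q
⟦area⟧ (just a) nothing  (just c) q = trans (⟦side⟧ c a q) (det-rotate c a q)
⟦area⟧ nothing  (just b) (just c) q = trans (⟦side⟧ b c q) (sym (det-rotate q b c))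
⟦area⟧ (just a) nothing  nothing  q =
  trans (⟦constant⟧ 0ℚ q) (sym (trans (det-rotate a q q) (det-degenerate q a)))
⟦area⟧ nothing  (just b) nothing  q =
  trans (⟦constant⟧ 0ℚ q) (sym (trans (sym (det-rotate q q b)) (det-degenerate q b)))
⟦area⟧ nothing  nothing  w        q = trans (⟦constant⟧ 0ℚ q) (sym (det-degenerate q (at q w)))

-- A decision tree for the position of an unknown point q: `vertical a s t` branches on whether q
-- lies to the left or to the right of a, `line a b s t` on whether a b q turns to the left or to
-- the right. At a leaf, `cup L M` and `cap L M` exhibit the cup or cap L, q, M, and `impossible ns`
-- refutes the hypotheses f ∷ fs met on the way to it: f plus the combination of f ∷ fs with
-- coefficients ns is a constant ≤ 0.
data Cert : Set where
  vertical   : Point → Cert → Cert → Cert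
  line       : Point → Point → Cert → Cert → Cert
  cup cap    : List Point → List Point → Cert
  impossible : List ℕ → Cert

-- One hypothesis must suffice, but it may be stronger than the form: lying right of `p₅` entails
-- lying right of `p₂`.
Entails : List Form → Form → Set
Entails Γ f = Any (f ≽_) Γ

Steps : List Form → List Vertex → Set
Steps Γ (u ∷ v ∷ V) = Entails Γ (step u v) × Steps Γ (v ∷ V)
Steps Γ _           = ⊤

LeftTurns : List Form → List Vertex → Set
LeftTurns Γ (u ∷ v ∷ w ∷ V) = Entails Γ (area u v w) × LeftTurns Γ (v ∷ w ∷ V)
LeftTurns Γ _               = ⊤

RightTurns : List Form → List Vertex → Set
RightTurns Γ (u ∷ v ∷ w ∷ V) = Entails Γ (area w v u) × RightTurns Γ (v ∷ w ∷ V)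
RightTurns Γ _               = ⊤

Refutes : List ℕ → List Form → Set
Refutes ns []       = ⊥
Refutes ns (f ∷ fs) = constant 0ℚ ≽ (f ⊕ combine ns (f ∷ fs))

vertices : List Point → List Point → List Vertex
vertices L M = map just L ++ nothing ∷ map just M

module Certificate (P : List Point) where

  Valid : List Form → Cert → Set
  Valid Γ (vertical a s t) =
    a ∈ P × Valid (step nothing (just a) ∷ Γ) s × Valid (step (just a) nothing ∷ Γ) t
  Valid Γ (line a b s t) =
    a ∈ P × b ∈ P × xc a ≢ xc b × Valid (side a b ∷ Γ) s × Valid (side b a ∷ Γ) t
  Valid Γ (cup L M) = All (_∈ P) L × All (_∈ P) M × length (vertices L M) ≡ 4 ×
    Steps Γ (vertices L M) × LeftTurns Γ (vertices L M)
  Valid Γ (cap L M) = All (_∈ P) L × All (_∈ P) M × length (vertices L M) ≡ 5 ×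
    Steps Γ (vertices L M) × RightTurns Γ (vertices L M)
  Valid Γ (impossible ns) = Refutes ns Γ

  entails? : ∀ Γ f → Dec (Entails Γ f)
  entails? Γ f = any? (f ≽?_) Γ

  steps? : ∀ Γ V → Dec (Steps Γ V)
  steps? Γ []          = yes tt
  steps? Γ (_ ∷ [])    = yes tt
  steps? Γ (u ∷ v ∷ V) = entails? Γ (step u v) ×-dec steps? Γ (v ∷ V)

  leftTurns? : ∀ Γ V → Dec (LeftTurns Γ V)
  leftTurns? Γ []              = yes tt
  leftTurns? Γ (_ ∷ [])        = yes tt
  leftTurns? Γ (_ ∷ _ ∷ [])    = yes tt
  leftTurns? Γ (u ∷ v ∷ w ∷ V) = entails? Γ (area u v w) ×-dec leftTurns? Γ (v ∷ w ∷ V)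

  rightTurns? : ∀ Γ V → Dec (RightTurns Γ V)
  rightTurns? Γ []              = yes tt
  rightTurns? Γ (_ ∷ [])        = yes tt
  rightTurns? Γ (_ ∷ _ ∷ [])    = yes tt
  rightTurns? Γ (u ∷ v ∷ w ∷ V) = entails? Γ (area w v u) ×-dec rightTurns? Γ (v ∷ w ∷ V)

  valid? : ∀ Γ t → Dec (Valid Γ t)
  valid? Γ (vertical a s t) = (a ∈? P) ×-dec (valid? _ s ×-dec valid? _ t)
  valid? Γ (line a b s t) =
    (a ∈? P) ×-dec ((b ∈? P) ×-dec (¬? (xc a ℚ.≟ xc b) ×-dec (valid? _ s ×-dec valid? _ t)))
  valid? Γ (cup L M) = all? (_∈? P) L ×-dec (all? (_∈? P) M ×-dec ((_ ℕ.≟ 4) ×-dec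
    (steps? Γ (vertices L M) ×-dec leftTurns? Γ (vertices L M))))
  valid? Γ (cap L M) = all? (_∈? P) L ×-dec (all? (_∈? P) M ×-dec ((_ ℕ.≟ 5) ×-dec
    (steps? Γ (vertices L M) ×-dec rightTurns? Γ (vertices L M))))
  valid? []       (impossible ns) = no λ ()
  valid? (f ∷ fs) (impossible ns) = _ ≽? (f ⊕ combine ns (f ∷ fs))

  module Sound {q : Point} (gen : Generic (q ∷ P)) where

    Holds : Form → Set
    Holds f = 0ℚ ℚ.< ⟦ f ⟧ q

    ≽-sound : ∀ {f g} → f ≽ g → ⟦ g ⟧ q ℚ.≤ ⟦ f ⟧ q
    ≽-sound {α , β , _} (refl , refl , γ′≤γ) = ℚ.+-monoʳ-≤ (α * xc q + β * yc q) γ′≤γ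

    entails-sound : ∀ {Γ f} → Entails Γ f → All Holds Γ → Holds f
    entails-sound e holds =
      let g , g∈ , f≽g = find e
      in ℚ.<-≤-trans (All.lookup holds g∈) (≽-sound f≽g)

    ⟦⊕⟧ : ∀ f g → ⟦ f ⊕ g ⟧ q ≡ ⟦ f ⟧ q + ⟦ g ⟧ q
    ⟦⊕⟧ (α , β , γ) (α′ , β′ , γ′) = solve 8 (λ α β γ α′ β′ γ′ x y →
      (α :+ α′) :* x :+ (β :+ β′) :* y :+ (γ :+ γ′) :=
      α :* x :+ β :* y :+ γ :+ (α′ :* x :+ β′ :* y :+ γ′)) refl α β γ α′ β′ γ′ (xc q) (yc q)

    ⟦⊙⟧ : ∀ n f → ⟦ n ⊙ f ⟧ q ≡ n * ⟦ f ⟧ q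
    ⟦⊙⟧ n (α , β , γ) = solve 6 (λ n α β γ x y →
      n :* α :* x :+ n :* β :* y :+ n :* γ := n :* (α :* x :+ β :* y :+ γ))
      refl n α β γ (xc q) (yc q)

    combine-sound : ∀ ns fs → All Holds fs → 0ℚ ℚ.≤ ⟦ combine ns fs ⟧ q
    combine-sound []       fs       _ = ℚ.≤-reflexive (sym (⟦constant⟧ 0ℚ q))
    combine-sound (n ∷ ns) []       _ = ℚ.≤-reflexive (sym (⟦constant⟧ 0ℚ q))
    combine-sound (n ∷ ns) (f ∷ fs) (0<f ∷ 0<fs) =
      subst (0ℚ ℚ.≤_) (sym (trans (⟦⊕⟧ ((+ n / 1) ⊙ f) (combine ns fs))
                                  (cong (_+ ⟦ combine ns fs ⟧ q) (⟦⊙⟧ (+ n / 1) f))))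
        (ℚ.+-mono-≤ 0≤nf (combine-sound ns fs 0<fs))
      where
      0≤nf : 0ℚ ℚ.≤ (+ n / 1) * ⟦ f ⟧ q
      0≤nf = subst (ℚ._≤ (+ n / 1) * ⟦ f ⟧ q) (ℚ.*-zeroʳ (+ n / 1))
        (ℚ.*-monoˡ-≤-nonNeg (+ n / 1) {{ℚ.normalize-nonNeg n 1}} (ℚ.<⇒≤ 0<f))

    -- `combine` alone is only nonnegative; the extra copy of the newest hypothesis makes the sum
    -- strictly positive, although it is a constant at most 0.
    refutes-sound : ∀ ns Γ → Refutes ns Γ → ¬ All Holds Γ
    refutes-sound ns (f ∷ fs) ref holds@(0<f ∷ _) = ℚ.<-irrefl refl
      (ℚ.<-≤-trans positive-sum
        (subst (⟦ f ⊕ combine ns (f ∷ fs) ⟧ q ℚ.≤_) (⟦constant⟧ 0ℚ q)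
          (≽-sound {constant 0ℚ} {f ⊕ combine ns (f ∷ fs)} ref)))
      where
      positive-sum : 0ℚ ℚ.< ⟦ f ⊕ combine ns (f ∷ fs) ⟧ q
      positive-sum = subst (0ℚ ℚ.<_) (sym (⟦⊕⟧ f (combine ns (f ∷ fs))))
        (ℚ.+-mono-<-≤ 0<f (combine-sound ns (f ∷ fs) holds))

    steps-sound : ∀ {Γ} V → Steps Γ V → All Holds Γ → XIncreasing (map (at q) V)
    steps-sound []          _         _     = tt
    steps-sound (_ ∷ [])    _         _     = tt
    steps-sound (u ∷ v ∷ V) (e , es) holds =
      0<y-x⇒x<y (subst (0ℚ ℚ.<_) (⟦step⟧ u v q) (entails-sound e holds)) ,
      steps-sound (v ∷ V) es holds

    leftTurns-sound : ∀ {Γ} V → LeftTurns Γ V → All Holds Γ → SlopesIncreasing (map (at q) V)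
    leftTurns-sound []              _        _     = tt
    leftTurns-sound (_ ∷ [])        _        _     = tt
    leftTurns-sound (_ ∷ _ ∷ [])    _        _     = tt
    leftTurns-sound (u ∷ v ∷ w ∷ V) (e , es) holds =
      slopeLt⁺ (at q u) (at q v) (at q w)
        (subst (0ℚ ℚ.<_) (⟦area⟧ u v w q) (entails-sound e holds)) ,
      leftTurns-sound (v ∷ w ∷ V) es holds

    rightTurns-sound : ∀ {Γ} V → RightTurns Γ V → All Holds Γ → SlopesDecreasing (map (at q) V)
    rightTurns-sound []              _        _     = tt
    rightTurns-sound (_ ∷ [])        _        _     = tt
    rightTurns-sound (_ ∷ _ ∷ [])    _        _     = tt
    rightTurns-sound (u ∷ v ∷ w ∷ V) (e , es) holds =
      slopeGt⁺ (at q u) (at q v) (at q w)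
        (subst (0ℚ ℚ.<_) (⟦area⟧ w v u q) (entails-sound e holds)) ,
      rightTurns-sound (v ∷ w ∷ V) es holds

    vertices∈ : ∀ L M → All (_∈ P) L → All (_∈ P) M → All (_∈ q ∷ P) (map (at q) (vertices L M))
    vertices∈ []      []      []        []        = here refl ∷ []
    vertices∈ []      (_ ∷ M) []        (p∈ ∷ M∈) =
      here refl ∷ there p∈ ∷ All.tail (vertices∈ [] M [] M∈)
    vertices∈ (_ ∷ L) M       (p∈ ∷ L∈) M∈        = there p∈ ∷ vertices∈ L M L∈ M∈

    distinct-x : a ∈ P → xc q ≢ xc a
    distinct-x = All.lookup (AllPairs.head (proj₁ gen))

    -- Genericity of `q ∷ P` excludes ties: `q` shares no x-coordinate with a given point and lies
    -- on no line through two of them, so the two branches at each node are exhaustive.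
    sound : ∀ Γ t → Valid Γ t → All Holds Γ → HasCup 4 (q ∷ P) ⊎ HasCap 5 (q ∷ P)
    sound Γ (vertical a s t) (a∈ , vs , vt) holds with ℚ.<-cmp (xc q) (xc a)
    ... | tri< q<a _ _ =
      sound _ s vs (subst (0ℚ ℚ.<_) (sym (⟦step⟧ nothing (just a) q)) (x<y⇒0<y-x q<a) ∷ holds)
    ... | tri≈ _ q≡a _ = contradiction q≡a (distinct-x a∈)
    ... | tri> _ _ a<q =
      sound _ t vt (subst (0ℚ ℚ.<_) (sym (⟦step⟧ (just a) nothing q)) (x<y⇒0<y-x a<q) ∷ holds)
    sound Γ (line a b s t) (a∈ , b∈ , a≢b , vs , vt) holds with 0ℚ ℚ.<? det a b q
    ... | yes 0<det = sound _ s vs (subst (0ℚ ℚ.<_) (sym (⟦side⟧ a b q)) 0<det ∷ holds)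
    ... | no  0≮det = sound _ t vt (subst (0ℚ ℚ.<_)
      (sym (trans (⟦side⟧ b a q) (det-swap a b q))) (neg-≢0 det≢0 0≮det) ∷ holds)
      where
      det≢0 : det a b q ≢ 0ℚ
      det≢0 = generic⇒det≢0 gen a b q (there a∈) (there b∈) (here refl)
        a≢b (≢-sym (distinct-x a∈)) (≢-sym (distinct-x b∈))
    sound Γ (cup L M) (L∈ , M∈ , len , steps , turns) holds = inj₁
      ( map (at q) V , vertices∈ L M L∈ M∈ , trans (length-map (at q) V) len
      , steps-sound V steps holds , leftTurns-sound V turns holds )
      where V = vertices L M
    sound Γ (cap L M) (L∈ , M∈ , len , steps , turns) holds = inj₂
      ( map (at q) V , vertices∈ L M L∈ M∈ , trans (length-map (at q) V) len
      , steps-sound V steps holds , rightTurns-sound V turns holds )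
      where V = vertices L M
    sound Γ (impossible ns) ref holds = contradiction holds (refutes-sound ns Γ ref)

-- This initial hypothesis takes care of the known points of `octad`: their coordinates are
-- integers, so a positive difference or determinant is at least 1 and the corresponding constant
-- form is entailed.
unit-holds : ∀ q → 0ℚ ℚ.< ⟦ constant 1ℚ ⟧ q
unit-holds q = subst (0ℚ ℚ.<_) (sym (⟦constant⟧ 1ℚ q)) (from-yes (0ℚ ℚ.<? 1ℚ))

-- Explicit sets of eight and ten points.

pt : ℕ → ℕ → Point
pt m n = + m / 1 , + n / 1

p₁ p₂ p₃ p₄ p₅ p₆ p₇ p₈ : Point
p₁ = pt 0 0
p₂ = pt 4 6
p₃ = pt 5 6
p₄ = pt 6 3
p₅ = pt 7 11
p₆ = pt 8 8
p₇ = pt 9 4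
p₈ = pt 10 4

-- Every gap has one of the 4-caps p₁ p₂ p₃ p₄ and p₄ p₅ p₆ p₇ on one side, which blocks points far
-- below, and one of the 3-cups p₁ p₂ p₅ and p₅ p₆ p₈ on one side, which blocks points far above.
octad : List Point
octad = p₁ ∷ p₂ ∷ p₃ ∷ p₄ ∷ p₅ ∷ p₆ ∷ p₇ ∷ p₈ ∷ []

certificate : Cert
certificate =
  -- The `vertical` nodes are a binary search for one of the nine strips between the x-coordinates;
  -- lines are compared only within a strip.
  vertical p₅
    (vertical p₃
      (vertical p₂
        (vertical p₁
          (line p₁ p₂
            (cup [] (p₁ ∷ p₂ ∷ p₅ ∷ []))
            (cap [] (p₁ ∷ p₂ ∷ p₃ ∷ p₄ ∷ [])))
          (line p₂ p₅
            (line p₂ p₃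
              (cup [] (p₂ ∷ p₃ ∷ p₅ ∷ []))
              (line p₁ p₂
                (cap (p₁ ∷ []) (p₂ ∷ p₃ ∷ p₄ ∷ []))
                (cup (p₁ ∷ []) (p₂ ∷ p₅ ∷ []))))
            (cap [] (p₂ ∷ p₅ ∷ p₆ ∷ p₇ ∷ []))))
        (line p₃ p₇
          (cup [] (p₃ ∷ p₇ ∷ p₈ ∷ []))
          (line p₃ p₅
            (line p₂ p₃
              (line p₁ p₂
                (line p₂ p₅
                  (line p₅ p₆
                    -- No point lies above the lines p₅ p₆ and p₂ p₅ and below p₃ p₇: the three
                    -- forms with factors 13, 5 and 7 add up to -168. The first factor is listed as
                    -- 12, as one copy of the newest hypothesis is always added.
                    (impossible (12 ∷ 5 ∷ 0 ∷ 0 ∷ 0 ∷ 7 ∷ []))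
                    (cap (p₂ ∷ []) (p₅ ∷ p₆ ∷ p₇ ∷ [])))
                  (cup (p₁ ∷ p₂ ∷ []) (p₅ ∷ [])))
                (cap (p₁ ∷ p₂ ∷ []) (p₃ ∷ p₇ ∷ [])))
              (cup (p₂ ∷ []) (p₃ ∷ p₅ ∷ [])))
            (cap [] (p₃ ∷ p₅ ∷ p₆ ∷ p₇ ∷ [])))))
      (vertical p₄
        (line p₃ p₄
          (line p₂ p₃
            (line p₃ p₅
              (line p₅ p₆
                (cup [] (p₅ ∷ p₆ ∷ p₈ ∷ []))
                (cap (p₃ ∷ []) (p₅ ∷ p₆ ∷ p₇ ∷ [])))
              (cup (p₂ ∷ p₃ ∷ []) (p₅ ∷ [])))
            (cap (p₁ ∷ p₂ ∷ p₃ ∷ []) (p₄ ∷ [])))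
          (line p₄ p₅
            (cup (p₃ ∷ []) (p₄ ∷ p₅ ∷ []))
            (cap [] (p₄ ∷ p₅ ∷ p₆ ∷ p₇ ∷ []))))
        (line p₄ p₅
          (line p₅ p₆
            (cup [] (p₅ ∷ p₆ ∷ p₈ ∷ []))
            (cap (p₄ ∷ []) (p₅ ∷ p₆ ∷ p₇ ∷ [])))
          (line p₃ p₄
            (cup (p₃ ∷ p₄ ∷ []) (p₅ ∷ []))
            (cap (p₁ ∷ p₂ ∷ p₃ ∷ p₄ ∷ []) [])))))
    (vertical p₇
      (vertical p₆
        (line p₄ p₆
          (line p₆ p₇
            (cup [] (p₆ ∷ p₇ ∷ p₈ ∷ []))
            (line p₁ p₂
              (line p₅ p₆
                (line p₄ p₅
                  (cup (p₁ ∷ p₄ ∷ p₅ ∷ []) [])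
                  (cap (p₄ ∷ p₅ ∷ []) (p₆ ∷ p₇ ∷ [])))
                (line p₆ p₈
                  (cup (p₅ ∷ []) (p₆ ∷ p₈ ∷ []))
                  (impossible (1 ∷ 0 ∷ 1 ∷ 0 ∷ 0 ∷ 0 ∷ 0 ∷ 14 ∷ []))))
              (line p₂ p₆
                (cap (p₁ ∷ p₂ ∷ []) (p₆ ∷ p₇ ∷ []))
                (line p₃ p₆
                  (line p₁ p₃
                    (impossible (3 ∷ 0 ∷ 5 ∷ 0 ∷ 0 ∷ 0 ∷ 0 ∷ 0 ∷ 14 ∷ []))
                    (cap (p₁ ∷ p₃ ∷ []) (p₆ ∷ p₇ ∷ [])))
                  (line p₂ p₃
                    (cup (p₂ ∷ p₃ ∷ []) (p₆ ∷ []))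
                    (line p₃ p₇
                      (cap (p₁ ∷ p₂ ∷ p₃ ∷ []) (p₇ ∷ []))
                      (impossible (0 ∷ 0 ∷ 0 ∷ 0 ∷ 0 ∷ 0 ∷ 2 ∷ 0 ∷ 0 ∷ 12 ∷ []))))))))
          (line p₃ p₄
            (cup (p₃ ∷ p₄ ∷ []) (p₆ ∷ []))
            (cap (p₁ ∷ p₂ ∷ p₃ ∷ p₄ ∷ []) [])))
        (line p₃ p₆
          (cup (p₂ ∷ p₃ ∷ p₆ ∷ []) [])
          (line p₆ p₇
            (cap (p₁ ∷ p₃ ∷ p₆ ∷ []) (p₇ ∷ []))
            (line p₇ p₈
              (cup (p₆ ∷ []) (p₇ ∷ p₈ ∷ []))
              (line p₃ p₄
                (line p₄ p₇
                  (line p₁ p₄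
                    -- The lines p₁ p₄ and p₇ p₈ meet exactly at x = 8, the x-coordinate of `p₆`.
                    -- The sum is the constant 0, which is contradictory because the hypotheses are
                    -- strict.
                    (impossible (0 ∷ 0 ∷ 0 ∷ 6 ∷ 0 ∷ 0 ∷ 3 ∷ []))
                    (cap (p₁ ∷ p₄ ∷ []) (p₇ ∷ p₈ ∷ [])))
                  (cup (p₃ ∷ p₄ ∷ []) (p₇ ∷ [])))
                (cap (p₁ ∷ p₂ ∷ p₃ ∷ p₄ ∷ []) []))))))
      (vertical p₈
        (line p₄ p₇
          (cup (p₂ ∷ p₄ ∷ p₇ ∷ []) [])
          (line p₃ p₇
            (line p₇ p₈
              (cap (p₁ ∷ p₄ ∷ p₇ ∷ []) (p₈ ∷ []))
              (cup (p₃ ∷ p₇ ∷ []) (p₈ ∷ [])))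
            (cap (p₁ ∷ p₂ ∷ p₃ ∷ p₇ ∷ []) [])))
        (line p₆ p₈
          (cup (p₅ ∷ p₆ ∷ p₈ ∷ []) [])
          (cap (p₁ ∷ p₂ ∷ p₆ ∷ p₈ ∷ []) []))))

certificate-valid : Certificate.Valid octad (constant 1ℚ ∷ []) certificate
certificate-valid = from-yes (Certificate.valid? octad (constant 1ℚ ∷ []) certificate)

generic? : ∀ P → Dec (Generic P)
generic? P = allPairs? (λ p q → ¬? (xc p ℚ.≟ xc q)) P ×-dec
  map′ (λ nc p q r p∈ q∈ r∈ → All.lookup (All.lookup (All.lookup nc p∈) q∈) r∈)
       (λ nc → All.tabulate λ p∈ → All.tabulate λ q∈ → All.tabulate λ r∈ → nc _ _ _ p∈ q∈ r∈)
       (all? (λ p → all? (λ q → all? (λ r →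
         (xc p ℚ.<? xc q) →-dec ((xc q ℚ.<? xc r) →-dec ¬? (collinear? p q r))) P) P) P)

hasCup? : ∀ n P → Dec (HasCup (2 ℕ.+ n) P)
hasCup? n P = map′ (hasRun⇒hasCup ∘ Cup.rightRun⇒hasRun) (Cup.hasRun⇒rightRun ∘ hasCup⇒hasRun)
  (Cup.rightRun? slopeLt? n P)

hasCap? : ∀ n P → Dec (HasCap (2 ℕ.+ n) P)
hasCap? n P = map′ (hasRun⇒hasCap ∘ Cap.rightRun⇒hasRun) (Cap.hasRun⇒rightRun ∘ hasCap⇒hasRun)
  (Cap.rightRun? slopeGt? n P)

cupCapFree? : ∀ k l P → Dec (CupCapFree (2 ℕ.+ k) (2 ℕ.+ l) P)
cupCapFree? k l P = generic? P ×-dec (¬? (hasCup? k P) ×-dec ¬? (hasCap? l P))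

octad-saturated : CupCapSaturated 4 5 octad
octad-saturated =
  from-yes (cupCapFree? 2 3 octad) ,
  λ q _ gen → Certificate.Sound.sound octad gen (constant 1ℚ ∷ []) certificate certificate-valid
    (unit-holds q ∷ [])

decad : List Point
decad = zipWith pt (upTo 10) (21 ∷ 21 ∷ 19 ∷ 33 ∷ 32 ∷ 33 ∷ 0 ∷ 7 ∷ 11 ∷ 6 ∷ [])

theorem10 : SatC≡ 4 5 8 × 8 < 10 × RamC≡ 4 5 10
theorem10 =
  ((octad , octad-saturated , refl) , cupCapSaturated⇒8≤length) ,
  ℕ.m≤m+n 9 1 ,
  (decad , from-yes (cupCapFree? 2 3 decad) , refl) , cupCapFree⇒length≤10
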